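{- Let $n\ge2$ be even and $0\le q\le p\le n$. On the strip of squares $\mathcal G_{2,n}$ on the torus, the number $b_{n,p,q}$ of distinct perfect matchings obtained from the highest weight matching by $p-q$ moves $\mathrm d_a$ and $q$ moves $\mathrm d_b$ equals $$b_{n,p,q}=\frac{1}{q!\,(p-q)!}\,n\,\frac{(n-q-1)!}{(n-q-p)!}=\frac{n}{n-q}\binom pq\binom{n-q}{p},$$ where the expressions are read as $0$ when $q>n-p$. Consequently the total number of perfect matchings of $\mathcal G_{2,n}$ with weight $(n_z,n_w)=(n/2-p,0)$ is $$b_{n,p}=\sum_{q=0}^{p}\frac{n\,(n-q-1)!}{q!\,(p-q)!\,(n-q-p)!},$$ where terms with $q>n-p$ are read as $0$.
   Context: Strip of squares. For even $n\ge2$, the strip of squares $\mathcal G_{2,n}$ on the torus is the multigraph with $2n$ nodes $(r,j)$, $r\in\mathbb Z/2$ (row; $r=0$ bottom, $r=1$ top), $j\in\mathbb Z/n$ (column). Node $(r,j)$ is black if $r+j$ is even and white otherwise, so there are $n$ black nodes, one in each column. There are $4n$ distinct edges (parallel edges count as different): horizontal edges $h_{r,j}$ joining $(r,j)$ and $(r,j+1)$, and vertical edges $v_{r,j}$ joining $(r,j)$ and $(r+1,j)$, where $v_{r,j}$ is thought of as going upwards from $(r,j)$; thus $v_{0,j}$ is internal and $v_{1,j}$ crosses the cycle $z$ of the torus. The up edge of a node $(r,j)$ is $v_{r,j}$ and its down edge is $v_{r+1,j}$ (indices mod 2). Weights. A perfect matching is a set of edges touching each node exactly once. Edges are directed from black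 to white. The $z$-weight $n_z$ of a matching $M$ is the sum over edges $v_{1,j}\in M$ of $+1$ if $(1,j)$ is black and $-1$ if $(1,j)$ is white. The $w$-weight $n_w$ of $M$ is the sum over edges $h_{r,n-1}\in M$ (those crossing the cycle $w$) of $+1$ if $(r,n-1)$ is black and $-1$ if $(r,n-1)$ is white. The weight of $M$ is the pair $(n_z,n_w)$. Moves. The highest weight matching is the one in which every black node is matched along its up edge (its weight is $(n/2,0)$). A move $\mathrm d_a$ is applied to a column whose black node is matched along its up edge, and replaces that edge by the down edge of the black node. A move $\mathrm d_b$ is applied to a pair of neighbouring columns $j,j+1$ (with $j\in\mathbb Z/n$; for $n=2$ the choices $j=0$ and $j=1$ are different) whose two black nodes are both matched along their up edges, and replaces these two vertical edges by $h_{0,j}$ and $h_{1,j}$. Each move lowers $n_z$ by one. The moves may be performed in any order. -}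

module Defs where

import Algebra.Properties.CommutativeMonoid.Sum as Sum
open import Data.Bool.Base using (Bool; if_then_else_)
open import Data.Fin.Base using (Fin; fromℕ; toℕ)
open import Data.Fin.Patterns using (0F; 1F)
open import Data.Fin.Subset using (Side; Subset; inside; outside)
open import Data.Integer.Base using (ℤ; +_; 0ℤ; 1ℤ; -1ℤ)
import Data.Integer.Base as ℤ
import Data.Integer.Properties as ℤ
open import Data.List.Base using (length)
open import Data.List.Membership.Propositional using () renaming (_∈_ to _∈ₗ_)
open import Data.List.Relation.Unary.Unique.Propositional using (Unique)
open import Data.Nat.Base using (ℕ; zero; suc; _+_; _*_; _∸_; _!; parity)
open import Data.Nat.Combinatorics using (_C_)
open import Data.Nat.DivMod using (_mod_)
open import Data.Nat.Properties using (_≤?_)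
open import Data.Parity.Base using (0ℙ)
open import Data.Parity.Properties using (_≟_)
open import Data.Product.Base using (∃; _×_; _,_)
open import Data.Product using (∃!)
open import Data.Rational.Base using (ℚ; 0ℚ)
import Data.Rational.Base as ℚ
import Data.Rational.Properties as ℚ
open import Data.Sum.Base using (_⊎_)
open import Data.Vec.Base using (Vec; lookup; replicate; tabulate; updateAt; _[_]≔_)
open import Function.Bundles using (_⇔_)
open import Relation.Binary.PropositionalEquality.Core using (_≡_)
open import Relation.Nullary.Decidable.Core using (Dec; does)

-- Successor in ℤ/n, wrapping from n-1 to 0.
next : ∀ {n} → Fin n → Fin n
next {suc n} j = suc (toℕ j) mod suc n

-- (row , column)
Node : ℕ → Set
Node n = Fin 2 × Fin n

Black : ∀ {n} → Node n → Set
Black (r , j) = parity (toℕ r + toℕ j) ≡ 0ℙ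

black? : ∀ {n} (x : Node n) → Dec (Black x)
black? (r , j) = parity (toℕ r + toℕ j) ≟ 0ℙ

data Edge (n : ℕ) : Set where
  h v : Fin 2 → Fin n → Edge n

base : ∀ {n} → Edge n → Node n
base (h r j) = r , j
base (v r j) = r , j

end : ∀ {n} → Edge n → Node n
end (h r j) = r , next j
end (v r j) = next r , j

_Touches_ : ∀ {n} → Edge n → Node n → Set
e Touches x = x ≡ base e ⊎ x ≡ end e

up : ∀ {n} → Node n → Edge n
up (r , j) = v r j

down : ∀ {n} → Node n → Edge n
down (r , j) = v (next r) j

-- Sets of edges, as bit tables indexed by row and column, so that _≡_ is
-- equality of sets.
record EdgeSet (n : ℕ) : Set where
  constructor edgeSet
  field
    hor ver : Vec (Subset n) 2

open EdgeSet public

member : ∀ {n} → EdgeSet n → Edge n → Bool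
member M (h r j) = lookup (lookup (hor M) r) j
member M (v r j) = lookup (lookup (ver M) r) j

infix 4 _∈_

_∈_ : ∀ {n} → Edge n → EdgeSet n → Set
e ∈ M = member M e ≡ inside

assign : ∀ {n} → Side → Edge n → EdgeSet n → EdgeSet n
assign s (h r j) M = record M { hor = updateAt (hor M) r (_[ j ]≔ s) }
assign s (v r j) M = record M { ver = updateAt (ver M) r (_[ j ]≔ s) }

insert remove : ∀ {n} → Edge n → EdgeSet n → EdgeSet n
insert = assign inside
remove = assign outside

IsPerfectMatching : ∀ {n} → EdgeSet n → Set
IsPerfectMatching M = ∀ x → ∃! _≡_ λ e → e ∈ M × e Touches x

sumℤ : ∀ {n} → (Fin n → ℤ) → ℤ
sumℤ = Sum.sum ℤ.+-0-commutativeMonoid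

sumℚ : ∀ {n} → (Fin n → ℚ) → ℚ
sumℚ = Sum.sum ℚ.+-0-commutativeMonoid

-- The signed contribution of an edge crossing one of the cycles z, w: the
-- edge is directed from black to white, so the sign is the colour of its base.
crossing : ∀ {n} → EdgeSet n → Edge n → ℤ
crossing M e =
  if member M e
  then (if does (black? (base e)) then 1ℤ else -1ℤ)
  else 0ℤ

zWeight : ∀ {n} → EdgeSet n → ℤ
zWeight M = sumℤ λ j → crossing M (v 1F j)

wWeight : ∀ {n} → EdgeSet n → ℤ
wWeight {zero}  M = 0ℤ
wWeight {suc m} M = sumℤ λ r → crossing M (h r (fromℕ m))

weight : ∀ {n} → EdgeSet n → ℤ × ℤ
weight M = zWeight M , wWeight M

-- The set of up edges of black nodes.
highest : ∀ n → EdgeSet n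
highest n = edgeSet
  (replicate 2 (replicate n outside))
  (tabulate λ r → tabulate λ j → does (black? (r , j)))

data MoveA {n} (M : EdgeSet n) : EdgeSet n → Set where
  dA : ∀ r j → Black (r , j) → up (r , j) ∈ M →
       MoveA M (insert (down (r , j)) (remove (up (r , j)) M))

data MoveB {n} (M : EdgeSet n) : EdgeSet n → Set where
  dB : ∀ r r′ j → Black (r , j) → Black (r′ , next j) →
       up (r , j) ∈ M → up (r′ , next j) ∈ M →
       MoveB M (insert (h 0F j) (insert (h 1F j)
                 (remove (up (r , j)) (remove (up (r′ , next j)) M))))

-- Obtained a b M: some sequence of a moves dA and b moves dB, in any order,
-- leads from the highest weight matching to M.
data Obtained {n} : ℕ → ℕ → EdgeSet n → Set where
  start : Obtained 0 0 (highest n)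
  stepA : ∀ {a b M M′} → Obtained a b M → MoveA M M′ → Obtained (suc a) b M′
  stepB : ∀ {a b M M′} → Obtained a b M → MoveB M M′ → Obtained a (suc b) M′

-- Exactly k elements satisfy P, however many proofs of P each of them has.
HasCount : {A : Set} → (A → Set) → ℕ → Set
HasCount P k = ∃ λ xs → Unique xs × length xs ≡ k × (∀ x → P x ⇔ x ∈ₗ xs)

fromNat : ℕ → ℚ
fromNat m = + m ℚ./ 1

-- The value at denominator 0 is immaterial: below, all denominators are
-- nonzero when 0 ≤ q ≤ p ≤ n, 0 < n and q ≤ n - p.
infixl 7 _÷_

_÷_ : ℕ → ℕ → ℚ
m ÷ zero      = 0ℚ
m ÷ d@(suc _) = + m ℚ./ d

-- In the range q ≤ p ≤ n, reads an expression as 0 when q > n - p.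
zeroUnless : ℕ → ℕ → ℕ → ℚ → ℚ
zeroUnless n p q x = if does (q ≤? n ∸ p) then x else 0ℚ

factorialFormula : ℕ → ℕ → ℕ → ℚ
factorialFormula n p q = zeroUnless n p q
  (1 ÷ (q ! * (p ∸ q) !) ℚ.* fromNat n ℚ.* ((n ∸ q ∸ 1) ! ÷ (n ∸ q ∸ p) !))

binomialFormula : ℕ → ℕ → ℕ → ℚ
binomialFormula n p q = zeroUnless n p q
  (n ÷ (n ∸ q) ℚ.* fromNat (p C q) ℚ.* fromNat ((n ∸ q) C p))

summand : ℕ → ℕ → ℕ → ℚ
summand n p q = zeroUnless n p q
  ((n * (n ∸ q ∸ 1) !) ÷ (q ! * (p ∸ q) ! * (n ∸ q ∸ p) !))

-- The sum over q = 0, …, p.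
sumFormula : ℕ → ℕ → ℚ
sumFormula n p = sumℚ {suc p} λ q → summand n p (toℕ q)

{-# OPTIONS --safe #-}

-- On a matching with n_w = 0 the two horizontal edges between any two columns
-- are both present or both absent: if they differed at one place they would
-- differ at every place, in particular across the cycle w, where their signs are
-- opposite.  Such matchings are therefore the tilings of the cyclic word of n
-- columns by single columns, in which the black node is matched up or down, and
-- by dimers of two neighbouring columns.  These are also the matchings that the
-- moves produce, a move d_a creating a down column and a move d_b a dimer.
--
-- A tiling with u up columns, a down columns and q dimers, n = u + a + 2q, either
-- has no dimer around the seam, giving (u+a+q)! / (u! a! q!) words, or consists of
-- such a dimer and one of (u+a+q-1)! / (u! a! (q-1)!) words.  The sum is
-- n (u+a+q-1)! / (u! a! q!).

module Submission where

open import Defs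
import Algebra.Properties.AbelianGroup as AbelianGroup
import Algebra.Properties.CommutativeMonoid.Sum as Sum
open import Data.Bool.Base using (Bool; true; false; not; _∧_; if_then_else_)
open import Data.Bool.Properties using (not-involutive)
open import Data.Empty using (⊥-elim)
open import Data.Fin.Base using (Fin; zero; suc; fromℕ; fromℕ<; inject₁; toℕ)
open import Data.Fin.Induction using (<-weakInduction)
open import Data.Fin.Patterns using (0F; 1F)
open import Data.Fin.Permutation using (permutation)
import Data.Fin.Properties as Fin
open import Data.Fin.Properties using (toℕ-injective; toℕ-fromℕ<; toℕ-fromℕ; toℕ-inject₁; toℕ<n)
open import Data.Fin.Relation.Unary.Top using (view; ‵fromℕ; ‵inject₁)
open import Data.Integer.Base using (+_; 0ℤ; _-_)
open import Data.Integer.Base as ℤ using (ℤ; 1ℤ; -1ℤ)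
import Data.Integer.Properties as ℤ
open import Data.List.Base as List using ([]; _∷_; _++_)
open import Data.List.Membership.Propositional.Properties using (∈-map⁺; ∈-map⁻; ∈-++⁺ˡ; ∈-++⁺ʳ; ∈-++⁻)
open import Data.List.Properties using (length-map; length-++)
open import Data.List.Relation.Unary.All using ([]; _∷_)
open import Data.List.Relation.Unary.AllPairs using ([]; _∷_)
open import Data.List.Relation.Unary.Any using (here; there)
import Data.List.Relation.Unary.Unique.Propositional.Properties as Unique
open import Data.Nat.Base using (ℕ; zero; suc; _+_; _*_; _∸_; _/_; _%_; _!; _≤_; _<_; pred; parity; NonZero; >-nonZero; z<s; s<s; s≤s; s≤s⁻¹)
open import Data.Nat.Combinatorics using (_C_; nCk≡n!/k![n-k]!; k![n∸k]!∣n!)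
open import Data.Nat.Divisibility using (_∣_; divides)
open import Data.Nat.DivMod using (m<n⇒m%n≡m; n%n≡0; m%n<n; m*n/n≡m; m/n*n≡m)
open import Data.Nat.Properties hiding (_≟_)
open import Data.Nat.Solver using (module +-*-Solver)
open import Data.Parity.Base using (0ℙ)
open import Data.Parity.Properties using (_≟_)
open import Data.Product.Base using (∃; _×_; _,_; proj₁; proj₂)
open import Data.Rational.Base as ℚ using (ℚ; fromℚᵘ; toℚᵘ)
import Data.Rational.Properties as ℚ
open import Data.Rational.Unnormalised.Base as ℚᵘ using (mkℚᵘ; *≡*)
import Data.Rational.Unnormalised.Properties as ℚᵘ
open import Data.Sum.Base using (_⊎_; inj₁; inj₂; [_,_]′)
open import Data.Vec.Base using (Vec; []; _∷_; _∷ʳ_; lookup; tabulate; replicate; map; countᵇ; updateAt; _[_]≔_)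
open import Data.Vec.Properties using (∷-injectiveʳ; ∷ʳ-injectiveˡ; lookup∘tabulate; tabulate∘lookup; tabulate-cong; lookup-map; lookup-replicate; lookup∘updateAt; lookup∘updateAt′; lookup∘update; lookup∘update′; []≔-idempotent; []≔-lookup; []≔-commutes)
open import Function.Base using (_∘_; _$_)
open import Function.Bundles using (_⇔_; mk⇔; Equivalence)
open import Function.Definitions using (Injective)
open import Relation.Binary.PropositionalEquality
import Relation.Binary.Reasoning.Setoid as SetoidReasoning
open import Relation.Nullary.Decidable using (dec-true; dec-false; does; yes; no)
open import Relation.Nullary.Negation using (¬_; contradiction)

open AbelianGroup ℤ.+-0-abelianGroup using (∙-cancelˡ; ∙-cancelʳ; //-rightDividesˡ; //-rightDividesʳ)
open Equivalence using (to; from)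
open Sum ℤ.+-0-commutativeMonoid using (∑-distrib-+; sum-cong-≗; sum-permute)

private variable
  A B : Set
  P Q : A → Set
  k l m n u a q : ℕ
  s t : Bool

-- Counting

count-⇔ : (∀ x → P x ⇔ Q x) → HasCount P k → HasCount Q k
count-⇔ P⇔Q (xs , uniq , len , P⇔∈) =
  xs , uniq , len , λ x → mk⇔ (to (P⇔∈ x) ∘ from (P⇔Q x)) (to (P⇔Q x) ∘ from (P⇔∈ x))

count-∅ : (∀ x → ¬ P x) → HasCount P 0
count-∅ ¬P = [] , [] , refl , λ x → mk⇔ (⊥-elim ∘ ¬P x) λ ()

count-singleton : (a : A) → HasCount (_≡ a) 1
count-singleton a = a ∷ [] , [] ∷ [] , refl , λ x → mk⇔ here λ { (here eq) → eq ; (there ()) }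

count-⊎ : (∀ x → P x → ¬ Q x) → HasCount P k → HasCount Q l →
          HasCount (λ x → P x ⊎ Q x) (k + l)
count-⊎ disjoint (xs , uxs , refl , P⇔∈) (ys , uys , refl , Q⇔∈) =
  xs ++ ys ,
  Unique.++⁺ uxs uys (λ (x∈ , y∈) → disjoint _ (from (P⇔∈ _) x∈) (from (Q⇔∈ _) y∈)) ,
  length-++ xs ,
  λ x → mk⇔ [ ∈-++⁺ˡ ∘ to (P⇔∈ x) , ∈-++⁺ʳ xs ∘ to (Q⇔∈ x) ]′
            ([ inj₁ ∘ from (P⇔∈ x) , inj₂ ∘ from (Q⇔∈ x) ]′ ∘ ∈-++⁻ xs)

count-image : {f : A → B} → Injective _≡_ _≡_ f → HasCount P k →
              HasCount (λ y → ∃ λ x → P x × y ≡ f x) k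
count-image {f = f} inj (xs , uniq , len , P⇔∈) =
  List.map f xs , Unique.map⁺ inj uniq , trans (length-map f xs) len ,
  λ y → mk⇔ (λ { (x , Px , refl) → ∈-map⁺ f (to (P⇔∈ x) Px) })
            (λ y∈ → let (x , x∈ , eq) = ∈-map⁻ f y∈ in x , from (P⇔∈ x) x∈ , eq)

-- Words of column states

-- U, D: the black node of the column is matched along its up, down edge.
-- L, R: the column is the left, right half of a pair of parallel horizontal edges.
data State : Set where
  U D L R : State

isU isD isL isR : State → Bool
isU U = true
isU _ = false
isD D = true
isD _ = false
isL L = true
isL _ = false
isR R = true
isR _ = false

#U #D #L : Vec State n → ℕ
#U = countᵇ isU
#D = countᵇ isD
#L = countᵇ isL

-- The bits record whether a dimer is open at the left and right end of the word.
Run : Bool → Vec State n → Bool → Set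
Run s []      t = s ≡ t
Run s (x ∷ c) t = isR x ≡ s × Run (isL x) c t

bit : Bool → ℕ
bit b = if b then 1 else 0

-- Every `R` closes a dimer opened by an `L` or open at the left end, and every `L` is closed unless
-- its dimer is open at the right end. So the number of `R` is `#L c + bit s` less `bit t`, and it
-- needs no counter of its own.
run-length : (c : Vec State n) → Run s c t →
             n + bit t ≡ #U c + #D c + (#L c + #L c) + bit s
run-length [] refl = refl
run-length (U ∷ c) (refl , r) = cong suc (run-length c r)
run-length (D ∷ c) (refl , r) = trans (cong suc (run-length c r)) $
  solve 3 (λ u d l → con 1 :+ (u :+ d :+ l :+ con 0) := u :+ (con 1 :+ d) :+ l :+ con 0) refl
    (#U c) (#D c) (#L c + #L c)
  where open +-*-Solver
run-length (L ∷ c) (refl , r) = trans (cong suc (run-length c r)) $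
  solve 2 (λ u l → con 1 :+ (u :+ (l :+ l) :+ con 1) := u :+ ((con 1 :+ l) :+ (con 1 :+ l)) :+ con 0) refl
    (#U c + #D c) (#L c)
  where open +-*-Solver
run-length (R ∷ c) (refl , r) = trans (cong suc (run-length c r)) $
  solve 1 (λ x → con 1 :+ (x :+ con 0) := x :+ con 1) refl
    (#U c + #D c + (#L c + #L c))
  where open +-*-Solver

-- Linear words: multinomial coefficients

Counts : ℕ → ℕ → ℕ → Vec State n → Set
Counts u a q c = #U c ≡ u × #D c ≡ a × #L c ≡ q

Linear : ℕ → ℕ → ℕ → Vec State n → Set
Linear u a q c = Run false c false × Counts u a q c

-- The multinomial coefficient `(u + a + q)! / (u! a! q!)`, with the denominator multiplied out so
-- that the induction stays in ℕ.
LinearCount : ℕ → ℕ → ℕ → ℕ → Set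
LinearCount n u a q = ∃ λ k → HasCount {Vec State n} (Linear u a q) k × k * (u ! * a ! * q !) ≡ (u + a + q) !

-- Among the words over U, D, LR, a letter that occurs x times is the first one in
-- the fraction x / (u + a + q) of them.
Part : (Vec State m → Vec State n) → ℕ → ℕ → ℕ → ℕ → Set
Part f u a q x = ∃ λ k → HasCount (λ w → Linear u a q (f w)) k ×
                         k * (u ! * a ! * q !) ≡ x * pred (u + a + q) !

-- Deleting the leading `U` leaves a word with one `U` fewer, and passing from `u !` to `suc u !`
-- costs exactly the factor `suc u`. The other two letters work in the same way.
part-U : (∀ u → n ≡ u + a + (q + q) → LinearCount n u a q) →
         suc n ≡ u + a + (q + q) → Part {n} (U ∷_) u a q u
part-U {u = zero} rec eq = 0 , count-∅ (λ { c (_ , () , _) }) , refl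
part-U {a = a} {q = q} {u = suc u} rec eq with rec u (suc-injective eq)
... | k , hc , k≡ = k ,
  count-⇔ (λ c → mk⇔ (λ (r , x , y) → (refl , r) , cong suc x , y)
                      (λ ((_ , r) , x , y) → r , suc-injective x , y)) hc ,
  trans (solve 5 (λ k u u! a! q! → k :* ((con 1 :+ u) :* u! :* a! :* q!) :=
                                    (con 1 :+ u) :* (k :* (u! :* a! :* q!))) refl k u (u !) (a !) (q !))
        (cong (suc u *_) k≡)
  where open +-*-Solver

part-D : (∀ a → n ≡ u + a + (q + q) → LinearCount n u a q) →
         suc n ≡ u + a + (q + q) → Part {n} (D ∷_) u a q a
part-D {a = zero} rec eq = 0 , count-∅ (λ { c (_ , _ , () , _) }) , refl
part-D {u = u} {q = q} {a = suc a} rec eq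
  with rec a (suc-injective (trans eq (cong (_+ (q + q)) (+-suc u a))))
... | k , hc , k≡ = k ,
  count-⇔ (λ c → mk⇔ (λ (r , x , y , z) → (refl , r) , x , cong suc y , z)
                      (λ ((_ , r) , x , y , z) → r , x , suc-injective y , z)) hc ,
  trans (solve 5 (λ k a u! a! q! → k :* (u! :* ((con 1 :+ a) :* a!) :* q!) :=
                                    (con 1 :+ a) :* (k :* (u! :* a! :* q!))) refl k a (u !) (a !) (q !))
        (cong (suc a *_) (trans k≡ (cong (λ x → pred (x + q) !) (sym (+-suc u a)))))
  where open +-*-Solver

double-suc : ∀ x q → x + (suc q + suc q) ≡ suc (suc (x + (q + q)))
double-suc = solve 2 (λ x q → x :+ ((con 1 :+ q) :+ (con 1 :+ q)) := con 2 :+ (x :+ (q :+ q))) refl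
  where open +-*-Solver

-- Serves both a dimer at the start of a word and a dimer around the seam: deleting either leaves a
-- linear word with `q` dimers.
extra-dimer : ∀ k u a q → k * (u ! * a ! * q !) ≡ (u + a + q) ! →
              k * (u ! * a ! * suc q !) ≡ suc q * pred (u + a + suc q) !
extra-dimer k u a q eq = begin
  k * (u ! * a ! * (suc q * q !))
    ≡⟨ solve 4 (λ k x q f → k :* (x :* ((con 1 :+ q) :* f)) := (con 1 :+ q) :* (k :* (x :* f))) refl k (u ! * a !) q (q !) ⟩
  suc q * (k * (u ! * a ! * q !))
    ≡⟨ cong (suc q *_) (trans eq (cong (λ x → pred x !) (sym (+-suc (u + a) q)))) ⟩
  suc q * pred (u + a + suc q) ! ∎
  where
  open ≡-Reasoning
  open +-*-Solver

part-LR : (∀ q → n ≡ u + a + (q + q) → LinearCount n u a q) →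
          suc (suc n) ≡ u + a + (q + q) → Part {n} (λ w → L ∷ R ∷ w) u a q q
part-LR {q = zero} rec eq = 0 , count-∅ (λ { c (_ , _ , _ , ()) }) , refl
part-LR {u = u} {a = a} {q = suc q} rec eq
  with rec q (suc-injective (suc-injective (trans eq (double-suc (u + a) q))))
... | k , hc , k≡ = k ,
  count-⇔ (λ c → mk⇔ (λ (r , x , y , z) → (refl , refl , r) , x , y , cong suc z)
                      (λ ((_ , _ , r) , x , y , z) → r , x , y , suc-injective z)) hc ,
  extra-dimer k u a q k≡

0<sum : suc n ≡ u + a + (q + q) → 0 < u + a + q
0<sum {u = suc u} eq = z<s
0<sum {u = zero} {suc a} eq = z<s
0<sum {u = zero} {zero} {suc q} eq = z<s

suc-pred-! : ∀ s → 0 < s → s * pred s ! ≡ s !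
suc-pred-! (suc s) _ = refl

-- The recursion of multinomial coefficients: the shares `u`, `a` and `q` of the three first letters
-- add up to `u + a + q`, which completes the factorial of its predecessor.
add-parts : ∀ u a q → 0 < u + a + q →
            Part {n} (U ∷_) u a q u → Part {n} (D ∷_) u a q a → Part {n} (L ∷_) u a q q →
            LinearCount (suc n) u a q
add-parts {n} u a q 0<s (k₁ , hc₁ , eq₁) (k₂ , hc₂ , eq₂) (k₃ , hc₃ , eq₃) =
  k₁ + (k₂ + k₃) ,
  count-⇔ (λ c → mk⇔ merge split)
    (count-⊎ (λ { _ (_ , _ , refl) (inj₁ (_ , _ , ())) ; _ (_ , _ , refl) (inj₂ (_ , _ , ())) })
      (count-image ∷-injectiveʳ hc₁)
      (count-⊎ (λ { _ (_ , _ , refl) (_ , _ , ()) })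
        (count-image ∷-injectiveʳ hc₂)
        (count-image ∷-injectiveʳ hc₃))) ,
  (begin
    (k₁ + (k₂ + k₃)) * d                ≡⟨ *-distribʳ-+ d k₁ (k₂ + k₃) ⟩
    k₁ * d + (k₂ + k₃) * d              ≡⟨ cong (λ x → k₁ * d + x) (*-distribʳ-+ d k₂ k₃) ⟩
    k₁ * d + (k₂ * d + k₃ * d)          ≡⟨ cong₂ _+_ eq₁ (cong₂ _+_ eq₂ eq₃) ⟩
    u * f + (a * f + q * f)             ≡⟨ solve 4 (λ u a q f → u :* f :+ (a :* f :+ q :* f) := (u :+ a :+ q) :* f) refl u a q f ⟩
    (u + a + q) * f                     ≡⟨ suc-pred-! (u + a + q) 0<s ⟩
    (u + a + q) !                       ∎)
  where
  open ≡-Reasoning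
  open +-*-Solver
  d = u ! * a ! * q !
  f = pred (u + a + q) !
  First : State → Vec State (suc n) → Set
  First x c = ∃ λ w → Linear u a q (x ∷ w) × c ≡ x ∷ w
  merge : ∀ {c} → First U c ⊎ (First D c ⊎ First L c) → Linear u a q c
  merge (inj₁ (_ , l , refl)) = l
  merge (inj₂ (inj₁ (_ , l , refl))) = l
  merge (inj₂ (inj₂ (_ , l , refl))) = l
  split : ∀ {c} → Linear u a q c → First U c ⊎ (First D c ⊎ First L c)
  split {U ∷ c} l = inj₁ (c , l , refl)
  split {D ∷ c} l = inj₂ (inj₁ (c , l , refl))
  split {L ∷ c} l = inj₂ (inj₂ (c , l , refl))
  split {R ∷ c} ((() , _) , _)

linear-count : ∀ n u a q → n ≡ u + a + (q + q) → LinearCount n u a q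
-- An `L` forces an `R` after it, so this part descends by two columns and has to look at the length
-- once more.
linear-count-L : ∀ n u a q → suc n ≡ u + a + (q + q) → Part {n} (L ∷_) u a q q

linear-count zero zero zero zero eq =
  1 , count-⇔ (λ { [] → mk⇔ (λ _ → refl , refl , refl , refl) (λ _ → refl) }) (count-singleton []) , refl
linear-count (suc n) u a q eq =
  add-parts u a q (0<sum {u = u} eq)
    (part-U (λ u → linear-count n u a q) eq)
    (part-D (λ a → linear-count n u a q) eq)
    (linear-count-L n u a q eq)

linear-count-L zero u a zero eq = 0 , count-∅ (λ { [] ((_ , ()) , _) }) , refl
linear-count-L zero u a (suc q) eq with () ← trans eq (double-suc (u + a) q)
linear-count-L (suc n) u a q eq with part-LR (λ q → linear-count n u a q) eq
... | k , hc , k≡ = k , count-⇔ (λ c → mk⇔ (λ { (_ , l , refl) → l }) split) (count-image ∷-injectiveʳ hc) , k≡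
  where
  split : ∀ {c : Vec State (suc n)} → Linear u a q (L ∷ c) → ∃ λ w → Linear u a q (L ∷ R ∷ w) × c ≡ R ∷ w
  split {U ∷ c} ((_ , () , _) , _)
  split {D ∷ c} ((_ , () , _) , _)
  split {L ∷ c} ((_ , () , _) , _)
  split {R ∷ c} l = c , l , refl

-- Cyclic words

open-right⇒∷ʳL : (c : Vec State (suc n)) → Run s c true →
                 ∃ λ w → Run s w false × c ≡ w ∷ʳ L
open-right⇒∷ʳL (L ∷ []) (refl , refl) = [] , refl , refl
open-right⇒∷ʳL (x ∷ c@(_ ∷ _)) (refl , r) with open-right⇒∷ʳL c r
... | w , r′ , eq = x ∷ w , (refl , r′) , cong (x ∷_) eq

∷ʳL-open-right : (w : Vec State n) → Run s w false → Run s (w ∷ʳ L) true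
∷ʳL-open-right []      refl    = refl , refl
∷ʳL-open-right (x ∷ w) (e , r) = e , ∷ʳL-open-right w r

countᵇ-∷ʳ : ∀ (p : State → Bool) (w : Vec State n) x → countᵇ p (w ∷ʳ x) ≡ bit (p x) + countᵇ p w
countᵇ-∷ʳ p [] x with p x
... | true = refl
... | false = refl
countᵇ-∷ʳ p (y ∷ w) x with p y | countᵇ-∷ʳ p w x
... | true  | eq = trans (cong suc eq) (sym (+-suc (bit (p x)) (countᵇ p w)))
... | false | eq = eq

Wrapping : ℕ → ℕ → ℕ → Vec State n → Set
Wrapping u a q c = Run true c true × Counts u a q c

-- A word open at both ends has the form `R ∷ (w ∷ʳ L)` with `w` linear on the `n` inner columns and
-- one dimer fewer.
wrapping-count : ∀ n u a q → 2 + n ≡ u + a + (q + q) →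
                 ∃ λ k → HasCount {Vec State (2 + n)} (Wrapping u a q) k ×
                         k * (u ! * a ! * q !) ≡ q * pred (u + a + q) !
wrapping-count n u a zero eq = 0 , count-∅ none , refl
  where
  none : (c : Vec State (2 + n)) → ¬ Wrapping u a 0 c
  none c (r , _ , _ , z) with w , _ , refl ← open-right⇒∷ʳL c r
                         with () ← trans (sym z) (countᵇ-∷ʳ isL w L)
wrapping-count n u a (suc q) eq
  with linear-count n u a q (suc-injective (suc-injective (trans eq (double-suc (u + a) q))))
... | k , hc , k≡ = k ,
  count-⇔ (λ c → mk⇔ close (open′ c)) (count-image (λ eq → ∷ʳ-injectiveˡ _ _ (∷-injectiveʳ eq)) hc) ,
  extra-dimer k u a q k≡
  where
  close : ∀ {c : Vec State (2 + n)} → (∃ λ w → Linear u a q w × c ≡ R ∷ (w ∷ʳ L)) → Wrapping u a (suc q) c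
  close (w , (r , x , y , z) , refl) =
    (refl , ∷ʳL-open-right w r) ,
    trans (countᵇ-∷ʳ isU w L) x , trans (countᵇ-∷ʳ isD w L) y , trans (countᵇ-∷ʳ isL w L) (cong suc z)
  open′ : ∀ c → Wrapping u a (suc q) c → ∃ λ w → Linear u a q w × c ≡ R ∷ (w ∷ʳ L)
  open′ (R ∷ c) ((_ , r) , x , y , z) with open-right⇒∷ʳL c r
  ... | w , r′ , refl =
    w , (r′ , trans (sym (countᵇ-∷ʳ isU w L)) x , trans (sym (countᵇ-∷ʳ isD w L)) y ,
         suc-injective (trans (sym (countᵇ-∷ʳ isL w L)) z)) , refl

-- The common bit tells whether a dimer lies across the seam between the last and the first column.
Cyclic : Vec State n → Set
Cyclic c = ∃ λ s → Run s c s

-- With equal bits at both ends, `run-length` gives `n = #U c + #D c + 2 #L c`, so the other two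
-- counts determine `#U c`.
run-#U : ∀ s (c : Vec State n) → Run s c s → n ≡ u + a + (q + q) → #D c ≡ a → #L c ≡ q → #U c ≡ u
run-#U {n} {u} {a} {q} s c r eq refl refl =
  +-cancelʳ-≡ (a + (q + q)) (#U c) u (begin
    #U c + (a + (q + q))    ≡⟨ +-assoc (#U c) a (q + q) ⟨
    #U c + a + (q + q)      ≡⟨ +-cancelʳ-≡ (bit s) n _ (run-length c r) ⟨
    n                       ≡⟨ eq ⟩
    u + a + (q + q)         ≡⟨ +-assoc u a (q + q) ⟩
    u + (a + (q + q))       ∎)
  where open ≡-Reasoning

cyclic-split : n ≡ u + a + (q + q) → (c : Vec State n) →
               (Linear u a q c ⊎ Wrapping u a q c) ⇔ (Cyclic c × #D c ≡ a × #L c ≡ q)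
cyclic-split eq c = mk⇔
  [ (λ (r , _ , yz) → (false , r) , yz) , (λ (r , _ , yz) → (true , r) , yz) ]′
  λ { ((false , r) , y , z) → inj₁ (r , run-#U false c r eq y z , y , z)
    ; ((true  , r) , y , z) → inj₂ (r , run-#U true  c r eq y z , y , z) }

-- In units of `pred (u + a + q) !` the linear words contribute `u + a + q` and the wrapping ones
-- `q`. The sum `u + a + (q + q)` is the number of columns.
cyclic-count : ∀ n u a q → 2 + n ≡ u + a + (q + q) →
               ∃ λ b → HasCount {Vec State (2 + n)} (λ c → Cyclic c × #D c ≡ a × #L c ≡ q) b ×
                       b * (u ! * a ! * q !) ≡ (2 + n) * pred (u + a + q) !
cyclic-count n u a q eq =
  let (k , hk , k≡) = linear-count (2 + n) u a q eq
      (l , hl , l≡) = wrapping-count n u a q eq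
  in k + l ,
     count-⇔ (cyclic-split eq) (count-⊎ disjoint hk hl) ,
     sum-eq k l k≡ l≡
  where
  open ≡-Reasoning
  d = u ! * a ! * q !
  f = pred (u + a + q) !
  disjoint : ∀ (c : Vec State (2 + n)) → Linear u a q c → ¬ Wrapping u a q c
  disjoint (R ∷ c) ((() , _) , _)
  disjoint (U ∷ c) _ ((() , _) , _)
  disjoint (D ∷ c) _ ((() , _) , _)
  disjoint (L ∷ c) _ ((() , _) , _)
  sum-eq : ∀ k l → k * d ≡ (u + a + q) ! → l * d ≡ q * f → (k + l) * d ≡ (2 + n) * f
  sum-eq k l k≡ l≡ = begin
    (k + l) * d                          ≡⟨ *-distribʳ-+ d k l ⟩
    k * d + l * d                        ≡⟨ cong₂ _+_ k≡ l≡ ⟩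
    (u + a + q) ! + q * f                ≡⟨ cong (_+ q * f) (suc-pred-! (u + a + q) (0<sum {u = u} eq)) ⟨
    (u + a + q) * f + q * f              ≡⟨ *-distribʳ-+ f (u + a + q) q ⟨
    (u + a + q + q) * f                  ≡⟨ cong (_* f) (trans (+-assoc (u + a) q q) (sym eq)) ⟩
    (2 + n) * f                          ∎

-- Perfect matchings as column words

-- Defined by cases and not through `mod`, so that it computes on `zero` and `suc j`; conditions on
-- neighbouring columns are therefore phrased with `prev`.
prev : Fin n → Fin n
prev {suc n} zero    = fromℕ n
prev {suc n} (suc j) = inject₁ j

next-fromℕ : ∀ n → next (fromℕ n) ≡ zero
next-fromℕ n = toℕ-injective $ trans (toℕ-fromℕ< (m%n<n (suc (toℕ (fromℕ n))) (suc n)))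
  (trans (cong (λ k → suc k % suc n) (toℕ-fromℕ n)) (n%n≡0 (suc n)))

next-inject₁ : (j : Fin n) → next (inject₁ j) ≡ suc j
next-inject₁ {n} j = toℕ-injective $ trans (toℕ-fromℕ< (m%n<n (suc (toℕ (inject₁ j))) (suc n)))
  (trans (cong (λ k → suc k % suc n) (toℕ-inject₁ j)) (m<n⇒m%n≡m (s<s (toℕ<n j))))

next-prev : (j : Fin n) → next (prev j) ≡ j
next-prev {suc n} zero    = next-fromℕ n
next-prev {suc n} (suc j) = next-inject₁ j

prev-next : (j : Fin n) → prev (next j) ≡ j
prev-next {suc n} j with view j
... | ‵fromℕ     = cong prev (next-fromℕ n)
... | ‵inject₁ i = cong prev (next-inject₁ i)

-- The form of `Cyclic` that is invariant under rotation and singles out no seam, as suits the moves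
-- and the weights.
Valid : Vec State n → Set
Valid c = ∀ j → isL (lookup c (prev j)) ≡ isR (lookup c j)

run⇒ : ∀ (x : State) (c : Vec State n) → Run s (x ∷ c) t →
       isR x ≡ s × (∀ j → isL (lookup (x ∷ c) (inject₁ j)) ≡ isR (lookup c j)) ×
       isL (lookup (x ∷ c) (fromℕ n)) ≡ t
run⇒ x [] (e , e′) = e , (λ ()) , e′
run⇒ x (y ∷ c) (e , r) with run⇒ y c r
... | e₁ , f , e₂ = e , (λ { zero → sym e₁ ; (suc j) → f j }) , e₂

⇒run : ∀ (x : State) (c : Vec State n) → isR x ≡ s →
       (∀ j → isL (lookup (x ∷ c) (inject₁ j)) ≡ isR (lookup c j)) →
       isL (lookup (x ∷ c) (fromℕ n)) ≡ t → Run s (x ∷ c) t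
⇒run x []      e f e′ = e , e′
⇒run x (y ∷ c) e f e′ = e , ⇒run y c (sym (f zero)) (f ∘ suc) e′

valid⇔cyclic : (c : Vec State (suc n)) → Valid c ⇔ Cyclic c
valid⇔cyclic (x ∷ c) = mk⇔
  -- The bit is `isR x`; validity at column `zero` compares it with the last column.
  (λ v → _ , ⇒run x c refl (v ∘ suc) (v zero))
  λ (s , r) → let (e , f , e′) = run⇒ x c r in
    λ { zero → trans e′ (sym e) ; (suc j) → f j }

even : ℕ → Bool
even k = does (parity k ≟ 0ℙ)

even-suc : ∀ k → even (suc k) ≡ not (even k)
even-suc zero          = refl
even-suc (suc zero)    = refl
even-suc (suc (suc k)) = even-suc k

black : Fin 2 → Fin n → Bool
black r j = does (black? (r , j))

black⇒ : ∀ r (j : Fin n) → Black (r , j) → black r j ≡ true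
black⇒ r j eq with black? (r , j)
... | yes _ = refl
... | no ¬p = contradiction eq ¬p

⇒black : ∀ r (j : Fin n) → black r j ≡ true → Black (r , j)
⇒black r j eq with black? (r , j)
... | yes p = p

black-next : ∀ r (j : Fin n) → black (next r) j ≡ not (black r j)
black-next 0F j = even-suc (toℕ j)
black-next 1F j = even-suc (suc (toℕ j))

-- The bit is the colour of the base of a vertical edge. With a black base the edge is the up edge
-- of the black node of its column, with a white base the down edge of that node.
vertical : Bool → State → Bool
vertical true  = isU
vertical false = isD

matching : Vec State n → EdgeSet n
matching c = edgeSet (replicate 2 (map isL c))
                     (tabulate λ r → tabulate λ j → vertical (black r j) (lookup c j))

member-h : ∀ (c : Vec State n) r j → member (matching c) (h r j) ≡ isL (lookup c j)
member-h c r j = trans (cong (λ x → lookup x j) (lookup-replicate r (map isL c))) (lookup-map j isL c)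

member-v : ∀ (c : Vec State n) r j → member (matching c) (v r j) ≡ vertical (black r j) (lookup c j)
member-v c 0F j = lookup∘tabulate _ j
member-v c 1F j = lookup∘tabulate _ j

lookup-ext : ∀ {xs ys : Vec A n} → (∀ i → lookup xs i ≡ lookup ys i) → xs ≡ ys
lookup-ext {xs = xs} {ys} eq =
  trans (sym (tabulate∘lookup xs)) (trans (tabulate-cong eq) (tabulate∘lookup ys))

member-ext : ∀ {M N : EdgeSet n} → (∀ e → member M e ≡ member N e) → M ≡ N
member-ext eq = cong₂ edgeSet
  (lookup-ext λ r → lookup-ext λ j → eq (h r j))
  (lookup-ext λ r → lookup-ext λ j → eq (v r j))

state-ext : ∀ {x y} → isL x ≡ isL y → isU x ≡ isU y → isD x ≡ isD y → x ≡ y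
state-ext {U} {U} _ _ _ = refl
state-ext {U} {D} _ () _
state-ext {U} {L} () _ _
state-ext {U} {R} _ () _
state-ext {D} {U} _ () _
state-ext {D} {D} _ _ _ = refl
state-ext {D} {L} () _ _
state-ext {D} {R} _ _ ()
state-ext {L} {U} () _ _
state-ext {L} {D} () _ _
state-ext {L} {L} _ _ _ = refl
state-ext {L} {R} () _ _
state-ext {R} {U} _ () _
state-ext {R} {D} _ _ ()
state-ext {R} {L} () _ _
state-ext {R} {R} _ _ _ = refl

-- A horizontal edge gives `isL`, and the two vertical edges of a column, whose bases have opposite
-- colours, give `isU` and `isD`. If all three bits are false the state is `R`.
matching-injective : ∀ {c d : Vec State n} → matching c ≡ matching d → c ≡ d
matching-injective {c = c} {d} eq = lookup-ext λ j →
  let eqv : ∀ r → vertical (black r j) (lookup c j) ≡ vertical (black r j) (lookup d j)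
      eqv r = trans (sym (member-v c r j)) (trans (cong (λ M → member M (v r j)) eq) (member-v d r j))
      isL≡ = trans (sym (member-h c 0F j)) (trans (cong (λ M → member M (h 0F j)) eq) (member-h d 0F j))
  in by-colour (black 0F j) (black-next 0F j) isL≡ (eqv 0F) (eqv 1F)
  where
  by-colour : ∀ {x y b′} b → b′ ≡ not b → isL x ≡ isL y →
              vertical b x ≡ vertical b y → vertical b′ x ≡ vertical b′ y → x ≡ y
  by-colour true  refl l u d = state-ext l u d
  by-colour false refl l d u = state-ext l u d

-- Perfect matchings, node by node

data ExactlyOne : Bool → Bool → Bool → Bool → Set where
  first  : ExactlyOne true false false false
  second : ExactlyOne false true false false
  third  : ExactlyOne false false true false
  fourth : ExactlyOne false false false true

-- Both vertical edges of a column touch both of its nodes, so the last two bits do not depend on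
-- the row.
LocallyPerfect : EdgeSet n → Set
LocallyPerfect M = ∀ r j → ExactlyOne (member M (h r (prev j))) (member M (h r j))
                                      (member M (v 0F j)) (member M (v 1F j))

data Incident {n} (r : Fin 2) (j : Fin n) : Edge n → Set where
  left   : Incident r j (h r (prev j))
  right  : Incident r j (h r j)
  bottom : Incident r j (v 0F j)
  top    : Incident r j (v 1F j)

touches⇒incident : ∀ {e : Edge n} {r j} → e Touches (r , j) → Incident r j e
touches⇒incident {e = h r j}  (inj₁ refl) = right
touches⇒incident {e = v 0F j} (inj₁ refl) = bottom
touches⇒incident {e = v 1F j} (inj₁ refl) = top
touches⇒incident {e = h r j}  (inj₂ refl) = subst (λ k → Incident r (next j) (h r k)) (prev-next j) left
touches⇒incident {e = v 0F j} (inj₂ refl) = bottom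
touches⇒incident {e = v 1F j} (inj₂ refl) = top

incident⇒touches : ∀ {e : Edge n} {r j} → Incident r j e → e Touches (r , j)
incident⇒touches {r = r} {j} left = inj₂ (cong (r ,_) (sym (next-prev j)))
incident⇒touches right = inj₁ refl
incident⇒touches {r = 0F} bottom = inj₁ refl
incident⇒touches {r = 1F} bottom = inj₂ refl
incident⇒touches {r = 0F} top = inj₂ refl
incident⇒touches {r = 1F} top = inj₁ refl

local⇒perfect : {M : EdgeSet n} → LocallyPerfect M → IsPerfectMatching M
local⇒perfect {M = M} loc (r , j) = 
  let (e , i , e∈ , uniq) = pick (loc r j) refl refl refl refl
  in e , (e∈ , incident⇒touches i) , λ (y∈ , t) → uniq (touches⇒incident t) y∈
  where
  clash : ∀ {b} {X : Set} → b ≡ false → b ≡ true → X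
  clash refl ()
  pick : ∀ {a b c d} → ExactlyOne a b c d → member M (h r (prev j)) ≡ a → member M (h r j) ≡ b →
         member M (v 0F j) ≡ c → member M (v 1F j) ≡ d →
         ∃ λ e → Incident r j e × e ∈ M × (∀ {y} → Incident r j y → y ∈ M → e ≡ y)
  pick first a b c d = _ , left , a , λ { left _ → refl ; right p → clash b p ; bottom p → clash c p ; top p → clash d p }
  pick second a b c d = _ , right , b , λ { left p → clash a p ; right _ → refl ; bottom p → clash c p ; top p → clash d p }
  pick third a b c d = _ , bottom , c , λ { left p → clash a p ; right p → clash b p ; bottom _ → refl ; top p → clash d p }
  pick fourth a b c d = _ , top , d , λ { left p → clash a p ; right p → clash b p ; bottom p → clash c p ; top _ → refl }

prev≢ : (j : Fin (2 + n)) → prev j ≢ j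
prev≢ zero    ()
prev≢ (suc j) eq = m≢1+m+n (toℕ j) (trans (sym (toℕ-inject₁ j)) (trans (cong toℕ eq) (cong suc (sym (+-identityʳ _)))))

-- With at least two columns the left and right edges of a node are distinct, even when they are
-- parallel, so uniqueness makes exactly one of the four bits true.
perfect⇒local : {M : EdgeSet (2 + n)} → IsPerfectMatching M → LocallyPerfect M
perfect⇒local {M = M} perfect r j with perfect (r , j)
... | e , (e∈ , t) , uniq = go (touches⇒incident t) e∈ (λ i y∈ → uniq (y∈ , incident⇒touches i))
  where
  off : ∀ {e y} → (y ∈ M → e ≡ y) → e ≢ y → member M y ≡ false
  off {y = y} f e≢y with member M y
  ... | true  = contradiction (f refl) e≢y
  ... | false = refl
  h≢ : ∀ {r} {i j : Fin n} → i ≢ j → h r i ≢ h r j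
  h≢ i≢j refl = i≢j refl
  go : ∀ {e} → Incident r j e → e ∈ M → (∀ {y} → Incident r j y → y ∈ M → e ≡ y) →
       ExactlyOne (member M (h r (prev j))) (member M (h r j)) (member M (v 0F j)) (member M (v 1F j))
  go left e∈ u rewrite e∈ | off (u right) (h≢ (prev≢ j)) | off (u bottom) (λ ()) | off (u top) (λ ()) = first
  go right e∈ u rewrite e∈ | off (u left) (h≢ (prev≢ j ∘ sym)) | off (u bottom) (λ ()) | off (u top) (λ ()) = second
  go bottom e∈ u rewrite e∈ | off (u right) (λ ()) | off (u left) (λ ()) | off (u top) (λ ()) = third
  go top e∈ u rewrite e∈ | off (u right) (λ ()) | off (u bottom) (λ ()) | off (u left) (λ ()) = fourth

state-exactlyOne : ∀ b x → ExactlyOne (isR x) (isL x) (vertical b x) (vertical (not b) x)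
state-exactlyOne true  U = third
state-exactlyOne false U = fourth
state-exactlyOne true  D = fourth
state-exactlyOne false D = third
state-exactlyOne true  L = second
state-exactlyOne false L = second
state-exactlyOne true  R = first
state-exactlyOne false R = first

matching-perfect : (c : Vec State n) → Valid c → IsPerfectMatching (matching c)
matching-perfect c valid = local⇒perfect local
  where
  local : LocallyPerfect (matching c)
  local r j
    rewrite member-h c r (prev j) | valid j | member-h c r j
          | member-v c 0F j | member-v c 1F j | black-next 0F j
    = state-exactlyOne (black 0F j) (lookup c j)

-- Weights

Balanced : EdgeSet n → Set
Balanced M = ∀ j → member M (h 0F j) ≡ member M (h 1F j)

-- For the two nodes of one column, which share `u` and `d`: three of the four bits determine the
-- last.
left≡⇒right≡ : ∀ {a b a′ b′ u d} → ExactlyOne a b u d → ExactlyOne a′ b′ u d → a ≡ a′ → b ≡ b′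
left≡⇒right≡ first  first  _  = refl
left≡⇒right≡ second second _  = refl
left≡⇒right≡ third  third  _  = refl
left≡⇒right≡ fourth fourth _  = refl

-- Equality of the two rows passes from each column to the next, starting across the cycle w: the
-- left neighbour of column `zero` is the last column.
balanced : {M : EdgeSet (suc n)} → LocallyPerfect M →
           member M (h 0F (fromℕ n)) ≡ member M (h 1F (fromℕ n)) → Balanced M
balanced local last = <-weakInduction _
  (left≡⇒right≡ (local 0F zero) (local 1F zero) last)
  (λ j → left≡⇒right≡ (local 0F (suc j)) (local 1F (suc j)))

sign : Bool → ℤ
sign b = if b then 1ℤ else -1ℤ

-- The two edges across w have bases of opposite colours, so their contributions cancel exactly when
-- both or neither is present. The left side is the unfolded sum over the two rows.
opposite-signs : ∀ {b′} x y b → b′ ≡ not b →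
  (if x then sign b else 0ℤ) ℤ.+ ((if y then sign b′ else 0ℤ) ℤ.+ 0ℤ) ≡ 0ℤ ⇔ x ≡ y
opposite-signs true  true  true  refl = mk⇔ (λ _ → refl) (λ _ → refl)
opposite-signs true  true  false refl = mk⇔ (λ _ → refl) (λ _ → refl)
opposite-signs true  false true  refl = mk⇔ (λ ()) (λ ())
opposite-signs true  false false refl = mk⇔ (λ ()) (λ ())
opposite-signs false true  true  refl = mk⇔ (λ ()) (λ ())
opposite-signs false true  false refl = mk⇔ (λ ()) (λ ())
opposite-signs false false b     refl = mk⇔ (λ _ → refl) (λ _ → refl)

wWeight≡0 : (M : EdgeSet (suc n)) → wWeight M ≡ 0ℤ ⇔ member M (h 0F (fromℕ n)) ≡ member M (h 1F (fromℕ n))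
wWeight≡0 {n} M = opposite-signs (member M (h 0F (fromℕ n))) (member M (h 1F (fromℕ n)))
  (black 0F (fromℕ n)) (black-next 0F (fromℕ n))

-- The first bit is the colour of the bottom node; if it is white, the two vertical edges exchange
-- their roles.
decode : Bool → Bool → Bool → Bool → State
decode true  b u d = if u then U else if d then D else if b then L else R
decode false b u d = decode true b d u

decode-correct : ∀ {a b u d} k → ExactlyOne a b u d → let x = decode k b u d in
  isR x ≡ a × isL x ≡ b × vertical k x ≡ u × vertical (not k) x ≡ d
decode-correct true  first  = refl , refl , refl , refl
decode-correct true  second = refl , refl , refl , refl
decode-correct true  third  = refl , refl , refl , refl
decode-correct true  fourth = refl , refl , refl , refl
decode-correct false first  = refl , refl , refl , refl
decode-correct false second = refl , refl , refl , refl
decode-correct false third  = refl , refl , refl , refl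
decode-correct false fourth = refl , refl , refl , refl

-- The states are read off at the bottom nodes, and balance carries the horizontal edges over to the
-- top row.
balanced⇒matching : {M : EdgeSet n} → LocallyPerfect M → Balanced M → ∃ λ c → Valid c × M ≡ matching c
balanced⇒matching {n} {M} local bal = c , valid , member-ext agree
  where
  state : Fin n → State
  state j = decode (black 0F j) (member M (h 0F j)) (member M (v 0F j)) (member M (v 1F j))
  c = tabulate state
  correct = λ j → decode-correct (black 0F j) (local 0F j)
  valid : Valid c
  valid j rewrite lookup∘tabulate state (prev j) | lookup∘tabulate state j =
    let (_ , isL≡ , _) = correct (prev j) ; (isR≡ , _) = correct j in trans isL≡ (sym isR≡)
  agree : ∀ e → member M e ≡ member (matching c) e
  agree (h 0F j) rewrite member-h c 0F j | lookup∘tabulate state j = sym (proj₁ (proj₂ (correct j)))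
  agree (h 1F j) = trans (sym (bal j)) (trans (agree (h 0F j)) (trans (member-h c 0F j) (sym (member-h c 1F j))))
  agree (v 0F j) rewrite member-v c 0F j | lookup∘tabulate state j = sym (proj₁ (proj₂ (proj₂ (correct j))))
  agree (v 1F j) rewrite member-v c 1F j | lookup∘tabulate state j | black-next 0F j = sym (proj₂ (proj₂ (proj₂ (correct j))))

indicator : Bool → ℤ
indicator b = + bit b

sum-indicator : ∀ p (c : Vec State n) → sumℤ (λ j → indicator (p (lookup c j))) ≡ + countᵇ p c
sum-indicator p [] = refl
sum-indicator p (x ∷ c) with p x
... | true  = cong (λ z → 1ℤ ℤ.+ z) (sum-indicator p c)
... | false = trans (ℤ.+-identityˡ _) (sum-indicator p c)

-- The black nodes of the top row lie in the odd columns. Each step of the induction splits off two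
-- columns, contributing 0 and 1.
sum-odd : ∀ k → sumℤ {k * 2} (λ j → indicator (black 1F j)) ≡ + k
sum-odd zero = refl
sum-odd (suc k) = trans (ℤ.+-identityˡ _) (cong (λ z → 1ℤ ℤ.+ z) (sum-odd k))

even-double : ∀ k → even (k * 2) ≡ true
even-double zero    = refl
even-double (suc k) = even-double k

-- Evenness of `n` matters at the seam: without it the first and the last column would have the same
-- colour.
black-prev : even n ≡ true → ∀ r (j : Fin n) → black r (prev j) ≡ not (black r j)
black-prev e 0F j = even-prev e j
  where
  even-prev : even n ≡ true → (j : Fin n) → even (toℕ (prev j)) ≡ not (even (toℕ j))
  even-prev {suc n} e zero = trans (cong even (toℕ-fromℕ n))
    (trans (even-suc (suc n)) (cong not e))
  even-prev e (suc j) = trans (cong even (toℕ-inject₁ j)) (even-suc (suc (toℕ j)))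
black-prev e 1F j = trans (black-next 0F (prev j)) (cong not (trans (black-prev e 0F j) (sym (black-next 0F j))))

z-term : State → Bool → ℤ
z-term x k = if vertical k x then sign k else 0ℤ

-- In state x of a column where the top node has colour k; the two terms in k ∧ isR x
-- and not k ∧ isL x belong to the two ends of a dimer and cancel in the cyclic sum.
z-term-identity : ∀ x k →
  z-term x k ℤ.+ (indicator (isD x) ℤ.+ indicator (isL x)) ℤ.+ indicator (k ∧ isR x) ≡
  indicator k ℤ.+ indicator (not k ∧ isL x)
z-term-identity U true  = refl
z-term-identity U false = refl
z-term-identity D true  = refl
z-term-identity D false = refl
z-term-identity L true  = refl
z-term-identity L false = refl
z-term-identity R true  = refl
z-term-identity R false = refl

-- Summing `z-term-identity` over the columns leaves the surplus `F` on one side and `G` on the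
-- other. Rotation by one column takes `G` to `F`, because an `L` has its `R` on the right and the
-- colour changes in between; so the two sums cancel.
zWeight-matching : ∀ k (c : Vec State (k * 2)) → Valid c →
                   zWeight (matching c) ℤ.+ + (#D c + #L c) ≡ + k
zWeight-matching k c valid = ∙-cancelʳ (sumℤ F) _ _ (begin
  zWeight (matching c) ℤ.+ + (#D c + #L c) ℤ.+ sumℤ F
    ≡⟨ cong₂ (λ z w → z ℤ.+ w ℤ.+ sumℤ F)
         (sum-cong-≗ λ j → cong (λ b → if b then sign (black 1F j) else 0ℤ) (member-v c 1F j))
         (trans (ℤ.pos-+ (#D c) (#L c)) (sym (trans (∑-distrib-+ iD iL) (cong₂ ℤ._+_ (sum-indicator isD c) (sum-indicator isL c))))) ⟩
  sumℤ Z ℤ.+ sumℤ (λ j → iD j ℤ.+ iL j) ℤ.+ sumℤ F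
    ≡⟨ cong (ℤ._+ sumℤ F) (∑-distrib-+ Z (λ j → iD j ℤ.+ iL j)) ⟨
  sumℤ (λ j → Z j ℤ.+ (iD j ℤ.+ iL j)) ℤ.+ sumℤ F
    ≡⟨ ∑-distrib-+ (λ j → Z j ℤ.+ (iD j ℤ.+ iL j)) F ⟨
  sumℤ (λ j → Z j ℤ.+ (iD j ℤ.+ iL j) ℤ.+ F j)
    ≡⟨ sum-cong-≗ (λ j → z-term-identity (lookup c j) (black 1F j)) ⟩
  sumℤ (λ j → indicator (black 1F j) ℤ.+ G j)
    ≡⟨ ∑-distrib-+ (λ j → indicator (black 1F j)) G ⟩
  sumℤ {k * 2} (λ j → indicator (black 1F j)) ℤ.+ sumℤ G
    ≡⟨ cong₂ ℤ._+_ (sum-odd k) (trans (sum-permute G rotation) (sum-cong-≗ shift)) ⟩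
  + k ℤ.+ sumℤ F ∎)
  where
  open ≡-Reasoning
  Z iD iL F G : Fin (k * 2) → ℤ
  Z j = z-term (lookup c j) (black 1F j)
  iD j = indicator (isD (lookup c j))
  iL j = indicator (isL (lookup c j))
  F j = indicator (black 1F j ∧ isR (lookup c j))
  G j = indicator (not (black 1F j) ∧ isL (lookup c j))
  rotation = permutation prev next prev-next next-prev
  shift : ∀ j → G (prev j) ≡ F j
  shift j rewrite black-prev (even-double k) 1F j | valid j =
    cong (λ b → indicator (b ∧ isR (lookup c j))) (not-involutive (black 1F j))

-- Moves

member-assign : ∀ s (e : Edge n) M → member (assign s e M) e ≡ s
member-assign s (h r j) M = trans (cong (λ x → lookup x j) (lookup∘updateAt r (hor M))) (lookup∘update j (lookup (hor M) r) s)
member-assign s (v r j) M = trans (cong (λ x → lookup x j) (lookup∘updateAt r (ver M))) (lookup∘update j (lookup (ver M) r) s)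

lookup-updateAt-other : ∀ {m} (r i : Fin m) (j k : Fin n) (s : A) (T : Vec (Vec A n) m) →
                     ¬ (i ≡ r × k ≡ j) →
                     lookup (lookup (updateAt T r (_[ j ]≔ s)) i) k ≡ lookup (lookup T i) k
lookup-updateAt-other r i j k s T ne with i Fin.≟ r
... | no i≢r = cong (λ x → lookup x k) (lookup∘updateAt′ i r i≢r T)
... | yes refl = trans (cong (λ x → lookup x k) (lookup∘updateAt i T))
                       (lookup∘update′ (λ k≡j → ne (refl , k≡j)) (lookup T i) s)

member-assign′ : ∀ s (e e′ : Edge n) M → e′ ≢ e → member (assign s e M) e′ ≡ member M e′
member-assign′ s (h r j) (h i k) M ne = lookup-updateAt-other r i j k s (hor M) λ { (refl , refl) → ne refl }
member-assign′ s (h r j) (v i k) M ne = refl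
member-assign′ s (v r j) (h i k) M ne = refl
member-assign′ s (v r j) (v i k) M ne = lookup-updateAt-other r i j k s (ver M) λ { (refl , refl) → ne refl }

unchanged : ∀ (p : A → Bool) (c : Vec A n) j {y} → p (lookup c j) ≡ p y →
            ∀ k → p (lookup (c [ j ]≔ y) k) ≡ p (lookup c k)
unchanged p c j {y} eq k with k Fin.≟ j
... | yes refl = trans (cong p (lookup∘update k c y)) (sym eq)
... | no k≢j   = cong p (lookup∘update′ k≢j c y)

next-row≢ : ∀ (r : Fin 2) → next r ≢ r
next-row≢ 0F ()
next-row≢ 1F ()

same-or-next : ∀ (r i : Fin 2) → i ≡ r ⊎ i ≡ next r
same-or-next 0F 0F = inj₁ refl
same-or-next 0F 1F = inj₂ refl
same-or-next 1F 0F = inj₂ refl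
same-or-next 1F 1F = inj₁ refl

v-row : ∀ {i i′} {k k′ : Fin n} → v i k ≡ v i′ k′ → i ≡ i′
v-row refl = refl

v-col : ∀ {i i′} {k k′ : Fin n} → v i k ≡ v i′ k′ → k ≡ k′
v-col refl = refl

white-next : ∀ r (j : Fin n) → Black (r , j) → black (next r) j ≡ false
white-next r j blk = trans (black-next r j) (cong not (black⇒ r j blk))

-- In column `j` the vertical edge based in row `r` is the up edge of the black node and the one
-- based in row `next r` its down edge. Horizontal edges do not change, as `U` and `D` agree on
-- `isL`.
matching-dA : ∀ (c : Vec State n) r j → Black (r , j) → lookup c j ≡ U →
             matching (c [ j ]≔ D) ≡ insert (down (r , j)) (remove (up (r , j)) (matching c))
matching-dA c r j blk cj = member-ext agree
  where
  M = matching c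
  M₁ = remove (up (r , j)) M
  M₂ = insert (down (r , j)) M₁
  agree : ∀ e → member (matching (c [ j ]≔ D)) e ≡ member M₂ e
  agree (h i k) = trans (member-h (c [ j ]≔ D) i k)
    (trans (unchanged isL c j (cong isL cj) k) (sym (member-h c i k)))
  agree (v i k) with k Fin.≟ j
  ... | no k≢j = trans (member-v (c [ j ]≔ D) i k) (trans
    (cong (vertical (black i k)) (lookup∘update′ k≢j c D)) (sym (trans
    (member-assign′ _ (down (r , j)) (v i k) M₁ (k≢j ∘ v-col)) (trans
    (member-assign′ _ (up (r , j)) (v i k) M (k≢j ∘ v-col)) (member-v c i k)))))
  ... | yes refl with same-or-next r i
  ... | inj₁ refl = trans (member-v (c [ j ]≔ D) i j) (trans
    (cong₂ vertical (black⇒ i j blk) (lookup∘update j c D)) (sym (trans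
    (member-assign′ _ (down (i , j)) (v i j) M₁ (next-row≢ i ∘ sym ∘ v-row)) (member-assign _ (v i j) M))))
  ... | inj₂ refl = trans (member-v (c [ j ]≔ D) (next r) j) (trans
    (cong₂ vertical (white-next r j blk) (lookup∘update j c D)) (sym (member-assign _ (down (r , j)) M₁)))

-- The states `L` and `R` have no vertical edges, and the down edges of the two black nodes are
-- absent already in state `U`, so removing the up edges suffices. To the right of column `next j`
-- nothing changes, as `U` and `R` agree on `isL`.
matching-dB : ∀ (c : Vec State n) r r′ j → Black (r , j) → Black (r′ , next j) → next j ≢ j →
             lookup c j ≡ U → lookup c (next j) ≡ U →
             matching ((c [ j ]≔ L) [ next j ]≔ R) ≡
             insert (h 0F j) (insert (h 1F j) (remove (up (r , j)) (remove (up (r′ , next j)) (matching c))))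
matching-dB {n} c r r′ j blk blk′ j′≢j cj cj′ = member-ext agree
  where
  j′ = next j
  c₁ = c [ j ]≔ L
  c₂ = c₁ [ j′ ]≔ R
  M = matching c
  M₁ = remove (up (r′ , j′)) M
  M₂ = remove (up (r , j)) M₁
  M₃ = insert (h 1F j) M₂
  M₄ = insert (h 0F j) M₃
  c₁j′ : lookup c₁ j′ ≡ U
  c₁j′ = trans (lookup∘update′ j′≢j c L) cj′
  c₂j : lookup c₂ j ≡ L
  c₂j = trans (lookup∘update′ (j′≢j ∘ sym) c₁ R) (lookup∘update j c L)
  vertical-L : ∀ b → vertical b L ≡ false
  vertical-L true  = refl
  vertical-L false = refl
  vertical-R : ∀ b → vertical b R ≡ false
  vertical-R true  = refl
  vertical-R false = refl
  agree-h : ∀ i k → member (matching c₂) (h i k) ≡ member M₄ (h i k)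
  agree-h i k with k Fin.≟ j
  agree-h 0F k | yes refl = trans (member-h c₂ 0F j) (trans (cong isL c₂j) (sym (member-assign _ (h 0F j) M₃)))
  agree-h 1F k | yes refl = trans (member-h c₂ 1F j) (trans (cong isL c₂j) (sym (trans
    (member-assign′ true (h 0F j) (h 1F j) M₃ (λ ())) (member-assign _ (h 1F j) M₂))))
  agree-h i k | no k≢j = trans (member-h c₂ i k) (trans (unchanged isL c₁ j′ (cong isL c₁j′) k) (trans
    (cong isL (lookup∘update′ k≢j c L)) (sym (trans
    (member-assign′ _ (h 0F j) (h i k) M₃ λ { refl → k≢j refl }) (trans
    (member-assign′ _ (h 1F j) (h i k) M₂ λ { refl → k≢j refl }) (member-h c i k))))))
  agree-v : ∀ i k → member (matching c₂) (v i k) ≡ member M₂ (v i k)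
  agree-v i k with k Fin.≟ j | k Fin.≟ j′
  ... | yes refl | yes eq = contradiction (sym eq) j′≢j
  ... | no k≢j | no k≢j′ = trans (member-v c₂ i k) (trans
    (cong (vertical (black i k)) (trans (lookup∘update′ k≢j′ c₁ R) (lookup∘update′ k≢j c L))) (sym (trans
    (member-assign′ _ (up (r , j)) (v i k) M₁ (k≢j ∘ v-col)) (trans
    (member-assign′ _ (up (r′ , j′)) (v i k) M (k≢j′ ∘ v-col)) (member-v c i k)))))
  ... | yes refl | no k≢j′ = trans (member-v c₂ i j) (trans (cong (vertical (black i j)) c₂j)
    (trans (vertical-L (black i j)) (sym removed)))
    where
    removed : member M₂ (v i j) ≡ false
    removed with same-or-next r i
    ... | inj₁ refl = member-assign _ (v i j) M₁
    ... | inj₂ refl = trans (member-assign′ _ (up (r , j)) (v i j) M₁ (next-row≢ r ∘ v-row)) (trans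
      (member-assign′ _ (up (r′ , j′)) (v i j) M (k≢j′ ∘ v-col)) (trans
      (member-v c i j) (cong₂ vertical (white-next r j blk) cj)))
  ... | no k≢j | yes refl = trans (member-v c₂ i j′) (trans (cong (vertical (black i j′)) (lookup∘update j′ c₁ R))
    (trans (vertical-R (black i j′)) (sym removed)))
    where
    removed : member M₂ (v i j′) ≡ false
    removed = trans (member-assign′ _ (up (r , j)) (v i j′) M₁ (k≢j ∘ v-col)) removed₁
      where
      removed₁ : member M₁ (v i j′) ≡ false
      removed₁ with same-or-next r′ i
      ... | inj₁ refl = member-assign _ (v i j′) M
      ... | inj₂ refl = trans (member-assign′ _ (up (r′ , j′)) (v i j′) M (next-row≢ r′ ∘ v-row)) (trans
        (member-v c i j′) (cong₂ vertical (white-next r′ j′ blk′) cj′))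
  agree : ∀ e → member (matching c₂) e ≡ member M₄ e
  agree (h i k) = agree-h i k
  agree (v i k) = agree-v i k

valid-≔ : ∀ {c : Vec State n} {j y} → Valid c → isL (lookup c j) ≡ isL y → isR (lookup c j) ≡ isR y →
          Valid (c [ j ]≔ y)
valid-≔ {c = c} {j} valid eqL eqR k =
  trans (unchanged isL c j eqL (prev k)) (trans (valid k) (sym (unchanged isR c j eqR k)))

-- Seen from outside the pair is unchanged: its left column keeps `isR` and its right column keeps
-- `isL`. Only the boundary inside the pair asks for a new condition. This covers both the creation
-- and the removal of a dimer.
valid-≔≔ : ∀ {c : Vec State n} {j x y} → next j ≢ j → Valid c →
          isR (lookup c j) ≡ isR x → isL (lookup c (next j)) ≡ isL y → isL x ≡ isR y →
          Valid ((c [ j ]≔ x) [ next j ]≔ y)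
valid-≔≔ {c = c} {j} {x} {y} j′≢j valid eqR eqL eq k with k Fin.≟ next j
... | yes refl = begin
  isL (lookup ((c [ j ]≔ x) [ next j ]≔ y) (prev (next j)))  ≡⟨ cong (λ i → isL (lookup ((c [ j ]≔ x) [ next j ]≔ y) i)) (prev-next j) ⟩
  isL (lookup ((c [ j ]≔ x) [ next j ]≔ y) j)    ≡⟨ cong isL (lookup∘update′ (j′≢j ∘ sym) (c [ j ]≔ x) y) ⟩
  isL (lookup (c [ j ]≔ x) j)                    ≡⟨ cong isL (lookup∘update j c x) ⟩
  isL x                                          ≡⟨ eq ⟩
  isR y                                          ≡⟨ cong isR (lookup∘update (next j) (c [ j ]≔ x) y) ⟨
  isR (lookup ((c [ j ]≔ x) [ next j ]≔ y) (next j)) ∎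
  where open ≡-Reasoning
... | no k≢j′ = begin
  isL (lookup ((c [ j ]≔ x) [ next j ]≔ y) (prev k))  ≡⟨ unchanged isL (c [ j ]≔ x) (next j) (trans (cong isL (lookup∘update′ j′≢j c x)) eqL) (prev k) ⟩
  isL (lookup (c [ j ]≔ x) (prev k))                  ≡⟨ cong isL (lookup∘update′ pk≢j c x) ⟩
  isL (lookup c (prev k))                             ≡⟨ valid k ⟩
  isR (lookup c k)                                    ≡⟨ unchanged isR c j eqR k ⟨
  isR (lookup (c [ j ]≔ x) k)                         ≡⟨ cong isR (lookup∘update′ k≢j′ (c [ j ]≔ x) y) ⟨
  isR (lookup ((c [ j ]≔ x) [ next j ]≔ y) k)         ∎
  where
  open ≡-Reasoning
  pk≢j : prev k ≢ j
  pk≢j eq = k≢j′ (trans (sym (next-prev k)) (cong next eq))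

-- The old letter is added on the left instead of being subtracted on the right.
countᵇ-≔ : ∀ p (c : Vec State n) j y → bit (p (lookup c j)) + countᵇ p (c [ j ]≔ y) ≡ bit (p y) + countᵇ p c
countᵇ-≔ p (x ∷ c) zero y with p x | p y
... | true  | true  = refl
... | true  | false = refl
... | false | true  = refl
... | false | false = refl
countᵇ-≔ p (x ∷ c) (suc j) y with p x
... | false = countᵇ-≔ p c j y
... | true  = trans (+-suc (bit (p (lookup c j))) _) (trans (cong suc (countᵇ-≔ p c j y)) (sym (+-suc (bit (p y)) _)))

countᵇ-≔-from : ∀ p {c : Vec State n} {j x} → lookup c j ≡ x → ∀ y →
               bit (p x) + countᵇ p (c [ j ]≔ y) ≡ bit (p y) + countᵇ p c
countᵇ-≔-from p {c} {j} refl y = countᵇ-≔ p c j y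

countᵇ-witness : ∀ p (c : Vec State n) {k} → countᵇ p c ≡ suc k → ∃ λ j → p (lookup c j) ≡ true
countᵇ-witness p (x ∷ c) eq with p x in px
... | true  = zero , px
... | false = let (j , pj) = countᵇ-witness p c eq in suc j , pj

countᵇ-none : ∀ p (c : Vec State n) → countᵇ p c ≡ 0 → ∀ j → p (lookup c j) ≡ false
countᵇ-none p (x ∷ c) eq j with p x in px
countᵇ-none p (x ∷ c) ()   j       | true
countᵇ-none p (x ∷ c) eq   zero    | false = px
countᵇ-none p (x ∷ c) eq   (suc j) | false = countᵇ-none p c eq j

isU⇒ : ∀ {x} → isU x ≡ true → x ≡ U
isU⇒ {U} _ = refl
isD⇒ : ∀ {x} → isD x ≡ true → x ≡ D
isD⇒ {D} _ = refl
isL⇒ : ∀ {x} → isL x ≡ true → x ≡ L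
isL⇒ {L} _ = refl
isR⇒ : ∀ {x} → isR x ≡ true → x ≡ R
isR⇒ {R} _ = refl

up∈matching⇒U : ∀ (c : Vec State n) r j → Black (r , j) → up (r , j) ∈ matching c → lookup c j ≡ U
up∈matching⇒U c r j blk ∈M = isU⇒ (trans
  (cong (λ b → vertical b (lookup c j)) (sym (black⇒ r j blk))) (trans (sym (member-v c r j)) ∈M))

U⇒up∈matching : ∀ (c : Vec State n) r j → Black (r , j) → lookup c j ≡ U → up (r , j) ∈ matching c
U⇒up∈matching c r j blk cj = trans (member-v c r j) (cong₂ vertical (black⇒ r j blk) cj)

black-row : (j : Fin n) → ∃ λ r → Black (r , j)
black-row j with black 0F j in eq
... | true  = 0F , ⇒black 0F j eq
... | false = 1F , ⇒black 1F j (trans (black-next 0F j) (cong not eq))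

highest-matching : ∀ n → highest n ≡ matching (replicate n U)
highest-matching n = member-ext agree
  where
  black-vertical : ∀ b → b ≡ vertical b U
  black-vertical true  = refl
  black-vertical false = refl
  agree-h : ∀ i k → member (highest n) (h i k) ≡ isL (lookup (replicate n U) k)
  agree-h 0F k = trans (lookup-replicate k _) (cong isL (sym (lookup-replicate k U)))
  agree-h 1F k = trans (lookup-replicate k _) (cong isL (sym (lookup-replicate k U)))
  agree-v : ∀ i k → member (highest n) (v i k) ≡ black i k
  agree-v 0F k = lookup∘tabulate _ k
  agree-v 1F k = lookup∘tabulate _ k
  agree : ∀ e → member (highest n) e ≡ member (matching (replicate n U)) e
  agree (h i k) = trans (agree-h i k) (sym (member-h (replicate n U) i k))
  agree (v i k) = trans (agree-v i k) (trans (black-vertical (black i k)) (sym (trans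
    (member-v (replicate n U) i k) (cong (vertical (black i k)) (lookup-replicate k U)))))

countᵇ-replicate : ∀ p n {x : State} → p x ≡ false → countᵇ p (replicate n x) ≡ 0
countᵇ-replicate p zero    eq = refl
countᵇ-replicate p (suc n) eq rewrite eq = countᵇ-replicate p n eq

next≢ : (j : Fin (2 + n)) → next j ≢ j
next≢ j eq = prev≢ j (trans (cong prev (sym eq)) (prev-next j))

-- A black node matched along its up edge means state `U`, so each move rewrites `U` to `D` or two
-- neighbouring `U` to `L` and `R`. The counts `#D` and `#L` thus record the moves in whatever order
-- they come.
obtained⇒matching : ∀ {M : EdgeSet (2 + n)} → Obtained a q M →
                    ∃ λ c → M ≡ matching c × Valid c × #D c ≡ a × #L c ≡ q
obtained⇒matching {n} start =
  replicate (2 + n) U , highest-matching (2 + n) ,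
  (λ j → trans (cong isL (lookup-replicate (prev j) U)) (cong isR (sym (lookup-replicate j U)))) ,
  countᵇ-replicate isD (2 + n) {U} refl , countᵇ-replicate isL (2 + n) {U} refl
obtained⇒matching (stepA o move) with obtained⇒matching o
obtained⇒matching (stepA o (dA r j blk up∈)) | c , refl , valid , refl , refl =
  c [ j ]≔ D , sym (matching-dA c r j blk cj) ,
  valid-≔ {c = c} valid (cong isL cj) (cong isR cj) ,
  countᵇ-≔-from isD {c} cj D , countᵇ-≔-from isL {c} cj D
  where cj = up∈matching⇒U c r j blk up∈
obtained⇒matching (stepB o move) with obtained⇒matching o
obtained⇒matching (stepB o (dB r r′ j blk blk′ up∈ up∈′)) | c , refl , valid , refl , refl =
  (c [ j ]≔ L) [ next j ]≔ R , sym (matching-dB c r r′ j blk blk′ (next≢ j) cj cj′) ,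
  valid-≔≔ {c = c} (next≢ j) valid (cong isR cj) (cong isL cj′) refl ,
  trans (countᵇ-≔-from isD {c [ j ]≔ L} c₁j′ R) (countᵇ-≔-from isD {c} cj L) ,
  trans (countᵇ-≔-from isL {c [ j ]≔ L} c₁j′ R) (countᵇ-≔-from isL {c} cj L)
  where
  cj = up∈matching⇒U c r j blk up∈
  cj′ = up∈matching⇒U c r′ (next j) blk′ up∈′
  c₁j′ : lookup (c [ j ]≔ L) (next j) ≡ U
  c₁j′ = trans (lookup∘update′ (next≢ j) c L) cj′

restore : ∀ (c : Vec A n) j {x y} → lookup c j ≡ x → (c [ j ]≔ y) [ j ]≔ x ≡ c
restore c j refl = trans ([]≔-idempotent c j) ([]≔-lookup c j)

-- Moves are undone one at a time, first every `D` and then every dimer, so the sequence found makes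
-- all moves `dB` before the moves `dA`.
matching⇒obtained : ∀ a b (c : Vec State (2 + n)) → Valid c → #D c ≡ a → #L c ≡ b → Obtained a b (matching c)
matching⇒obtained {n} zero zero c valid D≡ L≡ =
  subst (Obtained 0 0) (trans (highest-matching (2 + n)) (cong matching (lookup-ext all-U))) start
  where
  only-U : ∀ {x} → isD x ≡ false → isL x ≡ false → isR x ≡ false → x ≡ U
  only-U {U} _ _ _ = refl
  all-U : ∀ j → lookup (replicate (2 + n) U) j ≡ lookup c j
  -- A word without `L` has no `R` either, by validity.
  all-U j = trans (lookup-replicate j U) (sym (only-U (countᵇ-none isD c D≡ j) (countᵇ-none isL c L≡ j)
    (trans (sym (valid j)) (countᵇ-none isL c L≡ (prev j)))))
matching⇒obtained (suc a) b c valid D≡ L≡ with countᵇ-witness isD c D≡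
... | j , isDj with isD⇒ isDj | black-row j
... | cj | r , blk = stepA (matching⇒obtained a b c⁻
        (valid-≔ {c = c} valid (cong isL cj) (cong isR cj))
        (suc-injective (trans (countᵇ-≔-from isD {c} cj U) D≡))
        (trans (countᵇ-≔-from isL {c} cj U) L≡))
      (subst (MoveA (matching c⁻)) (trans (sym (matching-dA c⁻ r j blk c⁻j)) (cong matching (restore c j cj)))
        (dA r j blk (U⇒up∈matching c⁻ r j blk c⁻j)))
  where
  c⁻ = c [ j ]≔ U
  c⁻j = lookup∘update j c U
matching⇒obtained {n} zero (suc b) c valid D≡ L≡ with countᵇ-witness isL c L≡
... | j , isLj with isL⇒ isLj | black-row j | black-row (next j)
... | cj | r , blk | r′ , blk′ = stepB (matching⇒obtained zero b c⁻
        (valid-≔≔ {c = c} (next≢ j) valid (cong isR cj) (cong isL cj′) refl)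
        (trans (trans (countᵇ-≔-from isD {c₁} c₁j′ U) (countᵇ-≔-from isD {c} cj U)) D≡)
        (suc-injective (trans (trans (cong suc (countᵇ-≔-from isL {c₁} c₁j′ U)) (countᵇ-≔-from isL {c} cj U)) L≡)))
      (subst (MoveB (matching c⁻)) (trans (sym (matching-dB c⁻ r r′ j blk blk′ (next≢ j) c⁻j c⁻j′)) (cong matching restored))
        (dB r r′ j blk blk′ (U⇒up∈matching c⁻ r j blk c⁻j) (U⇒up∈matching c⁻ r′ (next j) blk′ c⁻j′)))
  where
  j≢j′ : j ≢ next j
  j≢j′ = next≢ j ∘ sym
  c₁ c⁻ : Vec State (2 + n)
  c₁ = c [ j ]≔ U
  c⁻ = c₁ [ next j ]≔ U
  cj′ : lookup c (next j) ≡ R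
  cj′ = isR⇒ (trans (sym (valid (next j))) (trans (cong (λ i → isL (lookup c i)) (prev-next j)) (cong isL cj)))
  c₁j′ : lookup c₁ (next j) ≡ R
  c₁j′ = trans (lookup∘update′ (next≢ j) c U) cj′
  c⁻j : lookup c⁻ j ≡ U
  c⁻j = trans (lookup∘update′ j≢j′ c₁ U) (lookup∘update j c U)
  c⁻j′ : lookup c⁻ (next j) ≡ U
  c⁻j′ = lookup∘update (next j) c₁ U
  restored : (c⁻ [ j ]≔ L) [ next j ]≔ R ≡ c
  restored = begin
    (c⁻ [ j ]≔ L) [ next j ]≔ R                ≡⟨ cong (_[ next j ]≔ R) ([]≔-commutes c₁ (next j) j (next≢ j)) ⟩
    ((c₁ [ j ]≔ L) [ next j ]≔ U) [ next j ]≔ R ≡⟨ cong (λ c → (c [ next j ]≔ U) [ next j ]≔ R) (restore c j cj) ⟩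
    (c [ next j ]≔ U) [ next j ]≔ R             ≡⟨ restore c (next j) cj′ ⟩
    c                                           ∎
    where open ≡-Reasoning

-- Factorial and binomial formulas

-- Rational quotients are handled as images of unnormalised fractions, whose equality is
-- cross-multiplication.
÷-cong : ∀ a b d e .{{_ : NonZero d}} .{{_ : NonZero e}} → a * e ≡ b * d → a ÷ d ≡ b ÷ e
÷-cong a b (suc d) (suc e) eq = ℚ.fromℚᵘ-cong {mkℚᵘ (+ a) d} {mkℚᵘ (+ b) e}
  (*≡* (trans (sym (ℤ.pos-* a (suc e))) (trans (cong +_ eq) (ℤ.pos-* b (suc d)))))

fromℚᵘ-homo-* : ∀ p q → fromℚᵘ p ℚ.* fromℚᵘ q ≡ fromℚᵘ (p ℚᵘ.* q)
fromℚᵘ-homo-* p q = ℚ.toℚᵘ-injective (begin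
  toℚᵘ (fromℚᵘ p ℚ.* fromℚᵘ q)           ≈⟨ ℚ.toℚᵘ-homo-* (fromℚᵘ p) (fromℚᵘ q) ⟩
  toℚᵘ (fromℚᵘ p) ℚᵘ.* toℚᵘ (fromℚᵘ q)   ≈⟨ ℚᵘ.*-cong (ℚ.toℚᵘ-fromℚᵘ p) (ℚ.toℚᵘ-fromℚᵘ q) ⟩
  p ℚᵘ.* q                               ≈⟨ ℚ.toℚᵘ-fromℚᵘ (p ℚᵘ.* q) ⟨
  toℚᵘ (fromℚᵘ (p ℚᵘ.* q))               ∎)
  where open SetoidReasoning ℚᵘ.≃-setoid

fromℚᵘ-homo-+ : ∀ p q → fromℚᵘ p ℚ.+ fromℚᵘ q ≡ fromℚᵘ (p ℚᵘ.+ q)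
fromℚᵘ-homo-+ p q = ℚ.toℚᵘ-injective (begin
  toℚᵘ (fromℚᵘ p ℚ.+ fromℚᵘ q)           ≈⟨ ℚ.toℚᵘ-homo-+ (fromℚᵘ p) (fromℚᵘ q) ⟩
  toℚᵘ (fromℚᵘ p) ℚᵘ.+ toℚᵘ (fromℚᵘ q)   ≈⟨ ℚᵘ.+-cong (ℚ.toℚᵘ-fromℚᵘ p) (ℚ.toℚᵘ-fromℚᵘ q) ⟩
  p ℚᵘ.+ q                               ≈⟨ ℚ.toℚᵘ-fromℚᵘ (p ℚᵘ.+ q) ⟨
  toℚᵘ (fromℚᵘ (p ℚᵘ.+ q))               ∎)
  where open SetoidReasoning ℚᵘ.≃-setoid

÷-* : ∀ a d b e .{{_ : NonZero d}} .{{_ : NonZero e}} → (a ÷ d) ℚ.* (b ÷ e) ≡ (a * b) ÷ (d * e)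
÷-* a (suc d) b (suc e) = trans (fromℚᵘ-homo-* (mkℚᵘ (+ a) d) (mkℚᵘ (+ b) e))
  (cong (λ z → fromℚᵘ (mkℚᵘ z (e + d * suc e))) (sym (ℤ.pos-* a b)))

fromNat-+ : ∀ a b → fromNat (a + b) ≡ fromNat a ℚ.+ fromNat b
fromNat-+ a b = sym (trans (fromℚᵘ-homo-+ (mkℚᵘ (+ a) 0) (mkℚᵘ (+ b) 0))
  (cong (λ z → fromℚᵘ (mkℚᵘ z 0)) (cong₂ ℤ._+_ (ℤ.*-identityʳ (+ a)) (ℤ.*-identityʳ (+ b)))))

count-sum : ∀ m (P : Fin m → A → Set) (f : Fin m → ℚ) →
            (∀ {i j x} → P i x → P j x → i ≡ j) →
            (∀ i → ∃ λ b → HasCount (P i) b × fromNat b ≡ f i) →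
            ∃ λ b → HasCount (λ x → ∃ λ i → P i x) b × fromNat b ≡ sumℚ f
count-sum zero    P f disjoint counts = 0 , count-∅ (λ { _ (() , _) }) , refl
count-sum {A} (suc m) P f disjoint counts
  with counts zero | count-sum m (P ∘ suc) (f ∘ suc) (λ p q → Fin.suc-injective (disjoint p q)) (counts ∘ suc)
... | b , hb , b≡ | b′ , hb′ , b′≡ =
  b + b′ , count-⇔ (λ x → mk⇔ join split) (count-⊎ (λ x p (i , q) → 0≢ (disjoint p q)) hb hb′) ,
  trans (fromNat-+ b b′) (cong₂ ℚ._+_ b≡ b′≡)
  where
  0≢ : ∀ {i : Fin m} → ¬ (zero ≡ Fin.suc i)
  0≢ ()
  join : ∀ {x} → P zero x ⊎ (∃ λ i → P (suc i) x) → ∃ λ i → P i x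
  join (inj₁ p)       = zero , p
  join (inj₂ (i , p)) = suc i , p
  split : ∀ {x} → (∃ λ i → P i x) → P zero x ⊎ (∃ λ i → P (suc i) x)
  split (zero  , p) = inj₁ p
  split (suc i , p) = inj₂ (i , p)

C-factorials : ∀ {n k} → k ≤ n → (n C k) * (k ! * (n ∸ k) !) ≡ n !
C-factorials {n} {k} k≤n = trans (cong (_* (k ! * (n ∸ k) !)) (nCk≡n!/k![n-k]! k≤n))
  (m/n*n≡m {{k !* n ∸ k !≢0}} (k![n∸k]!∣n! k≤n))

-- The equation for `b` is that of `cyclic-count` with `u = n - q - p` and `a = p - q`, where
-- `u + a + q = n - q`.
module _ {n p q} (q≤p : q ≤ p) (p≤n∸q : p ≤ n ∸ q) (0<n∸q : 0 < n ∸ q) {b}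
         (b≡ : b * ((n ∸ q ∸ p) ! * (p ∸ q) ! * q !) ≡ n * (n ∸ q ∸ 1) !) where

  private
    r = n ∸ q
    instance
      s≢0 : NonZero r
      s≢0 = >-nonZero 0<n∸q
      q!≢0 = q !≢0
      a!≢0 = (p ∸ q) !≢0
      u!≢0 = (r ∸ p) !≢0
      p!≢0 = p !≢0
      qa≢0 : NonZero (q ! * (p ∸ q) !)
      qa≢0 = m*n≢0 (q !) ((p ∸ q) !)
      qau≢0 : NonZero (q ! * (p ∸ q) ! * (r ∸ p) !)
      qau≢0 = m*n≢0 (q ! * (p ∸ q) !) ((r ∸ p) !)
      uaqp≢0 : NonZero ((r ∸ p) ! * (p ∸ q) ! * q ! * p !)
      uaqp≢0 = m*n≢0 ((r ∸ p) ! * (p ∸ q) ! * q !) (p !) {{m*n≢0 ((r ∸ p) ! * (p ∸ q) !) (q !) {{m*n≢0 ((r ∸ p) !) ((p ∸ q) !)}}}}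

  count≡summand : fromNat b ≡ (n * (r ∸ 1) !) ÷ (q ! * (p ∸ q) ! * (r ∸ p) !)
  count≡summand = ÷-cong b (n * (r ∸ 1) !) 1 (q ! * (p ∸ q) ! * (r ∸ p) !) (trans
    (solve 4 (λ b q a u → b :* (q :* a :* u) := b :* (u :* a :* q)) refl b (q !) ((p ∸ q) !) ((r ∸ p) !))
    (trans b≡ (sym (*-identityʳ _))))
    where open +-*-Solver

  factorial≡summand : 1 ÷ (q ! * (p ∸ q) !) ℚ.* fromNat n ℚ.* ((r ∸ 1) ! ÷ (r ∸ p) !) ≡
                      (n * (r ∸ 1) !) ÷ (q ! * (p ∸ q) ! * (r ∸ p) !)
  factorial≡summand = begin
    1 ÷ (q ! * (p ∸ q) !) ℚ.* (n ÷ 1) ℚ.* ((r ∸ 1) ! ÷ (r ∸ p) !)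
      ≡⟨ cong (ℚ._* ((r ∸ 1) ! ÷ (r ∸ p) !)) (÷-* 1 (q ! * (p ∸ q) !) n 1) ⟩
    ((1 * n) ÷ (q ! * (p ∸ q) ! * 1)) ℚ.* ((r ∸ 1) ! ÷ (r ∸ p) !)
      ≡⟨ cong₂ (λ x y → (x ÷ y) ℚ.* ((r ∸ 1) ! ÷ (r ∸ p) !)) (*-identityˡ n) (*-identityʳ (q ! * (p ∸ q) !)) ⟩
    (n ÷ (q ! * (p ∸ q) !)) ℚ.* ((r ∸ 1) ! ÷ (r ∸ p) !)
      ≡⟨ ÷-* n (q ! * (p ∸ q) !) ((r ∸ 1) !) ((r ∸ p) !) ⟩
    (n * (r ∸ 1) !) ÷ (q ! * (p ∸ q) ! * (r ∸ p) !) ∎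
    where open ≡-Reasoning

  -- Multiplying by `u! * a! * q! * p!` clears both binomial coefficients: `q! * a!` turns `p C q`
  -- into `p !`, and `p! * u!` turns `r C p` into `r !`, that is `r * (r ∸ 1) !`.
  count*s : b * r ≡ n * (p C q) * (r C p)
  count*s = *-cancelʳ-≡ _ _ ((r ∸ p) ! * (p ∸ q) ! * q ! * p !) (begin
    b * r * (u! * a! * q! * p!)
      ≡⟨ solve 4 (λ b r x p → b :* r :* (x :* p) := b :* x :* r :* p) refl b r (u! * a! * q!) p! ⟩
    b * (u! * a! * q!) * r * p!
      ≡⟨ cong (λ x → x * r * p!) b≡ ⟩
    n * (r ∸ 1) ! * r * p!
      ≡⟨ solve 4 (λ n f r p → n :* f :* r :* p := n :* p :* (r :* f)) refl n ((r ∸ 1) !) r p! ⟩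
    n * p! * (r * (r ∸ 1) !)
      ≡⟨ cong₂ (λ x y → n * x * y) (sym (C-factorials q≤p)) (trans (suc-pred-! r 0<n∸q) (sym (C-factorials p≤n∸q))) ⟩
    n * ((p C q) * (q! * a!)) * ((r C p) * (p! * u!))
      ≡⟨ solve 7 (λ n c d q a p u → n :* (c :* (q :* a)) :* (d :* (p :* u)) := n :* c :* d :* (u :* a :* q :* p)) refl n (p C q) (r C p) q! a! p! u! ⟩
    n * (p C q) * (r C p) * (u! * a! * q! * p!) ∎)
    where
    open ≡-Reasoning
    open +-*-Solver
    u! = (r ∸ p) !
    a! = (p ∸ q) !
    q! = q !
    p! = p !

  count≡binomial : fromNat b ≡ n ÷ r ℚ.* fromNat (p C q) ℚ.* fromNat (r C p)
  count≡binomial = begin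
    b ÷ 1
      ≡⟨ ÷-cong b (n * (p C q) * (r C p)) 1 r (trans count*s (sym (*-identityʳ _))) ⟩
    (n * (p C q) * (r C p)) ÷ r
      ≡⟨ cong ((n * (p C q) * (r C p)) ÷_) (*-identityʳ r) ⟨
    (n * (p C q) * (r C p)) ÷ (r * 1)
      ≡⟨ ÷-* (n * (p C q)) r (r C p) 1 ⟨
    ((n * (p C q)) ÷ r) ℚ.* fromNat (r C p)
      ≡⟨ cong (λ x → ((n * (p C q)) ÷ x) ℚ.* fromNat (r C p)) (*-identityʳ r) ⟨
    ((n * (p C q)) ÷ (r * 1)) ℚ.* fromNat (r C p)
      ≡⟨ cong (ℚ._* fromNat (r C p)) (÷-* n r (p C q) 1) ⟨
    n ÷ r ℚ.* fromNat (p C q) ℚ.* fromNat (r C p) ∎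
    where open ≡-Reasoning

-- Words with given numbers of down columns and dimers

Configuration : ℕ → ℕ → Vec State n → Set
Configuration a q c = Valid c × #D c ≡ a × #L c ≡ q

configuration-size : ∀ {a q} (c : Vec State (suc n)) → Configuration a q c → a + q + q ≤ suc n
configuration-size {n} c (valid , refl , refl) with to (valid⇔cyclic c) valid
... | s , r = begin
  #D c + #L c + #L c            ≡⟨ +-assoc (#D c) (#L c) (#L c) ⟩
  #D c + (#L c + #L c)          ≤⟨ m≤n+m _ (#U c) ⟩
  #U c + (#D c + (#L c + #L c)) ≡⟨ +-assoc (#U c) (#D c) _ ⟨
  #U c + #D c + (#L c + #L c)   ≡⟨ +-cancelʳ-≡ (bit s) (suc n) _ (run-length c r) ⟨
  suc n                         ∎
  where open ≤-Reasoning

-- The down columns and dimers would occupy `(p - q) + 2 q = p + q` columns, more than there are;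
-- hence the value 0 of the formulas in this range.
configuration-none : ∀ {m p q} → q ≤ p → ¬ (q ≤ suc m ∸ p) → (c : Vec State (suc m)) → ¬ Configuration (p ∸ q) q c
configuration-none {m} {p} {q} q≤p q≰ c conf = q≰ (m+n≤o⇒m≤o∸n q
  (subst (_≤ suc m) (trans (cong (_+ q) (m∸n+n≡m q≤p)) (+-comm p q)) (configuration-size c conf)))

CountFormulas : ℕ → ℕ → ℕ → ℕ → Set
CountFormulas n p q b = fromNat b ≡ factorialFormula n p q
                      × factorialFormula n p q ≡ binomialFormula n p q
                      × fromNat b ≡ summand n p q

formulas-≤ : ∀ {m p q b} (let n = suc m) → q ≤ p → p ≤ n → q ≤ n ∸ p → 0 < n ∸ q →
             b * ((n ∸ q ∸ p) ! * (p ∸ q) ! * q !) ≡ n * (n ∸ q ∸ 1) ! → CountFormulas n p q b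
formulas-≤ {m} {p} {q} {b} q≤p p≤n q≤ 0<n∸q b≡
  rewrite dec-true (q ≤? suc m ∸ p) q≤ =
  trans count (sym fact) , trans fact (trans (sym count) (count≡binomial q≤p p≤n∸q 0<n∸q {b} b≡)) , count
  where
  p≤n∸q : p ≤ suc m ∸ q
  p≤n∸q = m+n≤o⇒m≤o∸n p (subst (_≤ suc m) (+-comm q p) (m≤o∸n⇒m+n≤o q p≤n q≤))
  count = count≡summand q≤p p≤n∸q 0<n∸q {b} b≡
  fact = factorial≡summand q≤p p≤n∸q 0<n∸q {b} b≡

configuration-count : ∀ m p q → q ≤ p → p ≤ 2 + m → 
  ∃ λ b → HasCount {Vec State (2 + m)} (Configuration (p ∸ q) q) b × CountFormulas (2 + m) p q b
configuration-count m p q q≤p p≤n with q ≤? 2 + m ∸ p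
... | no q≰ = 0 , count-∅ (configuration-none q≤p q≰) , zero-formulas
  where
  zero-formulas : CountFormulas (2 + m) p q 0
  zero-formulas rewrite dec-false (q ≤? 2 + m ∸ p) q≰ = refl , refl , refl
... | yes q≤ =
  let (b , hc , b≡) = cyclic-count m u′ a′ q n≡
  in b ,
     count-⇔ (λ c → mk⇔ (λ (cy , eqs) → from (valid⇔cyclic c) cy , eqs) (λ (va , eqs) → to (valid⇔cyclic c) va , eqs)) hc ,
     formulas-≤ {b = b} q≤p p≤n q≤ (subst (0 <_) s≡ (0<sum {u = u′} n≡))
       (trans b≡ (cong (λ x → (2 + m) * pred x !) s≡))
  where
  -- The number of up columns, `n - (p - q) - 2 q`. With it the word has `n - q` letters, a dimer
  -- counting as one.
  u′ = 2 + m ∸ q ∸ p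
  a′ = p ∸ q
  q+p≤n : q + p ≤ 2 + m
  q+p≤n = m≤o∸n⇒m+n≤o q p≤n q≤
  p≤n∸q : p ≤ 2 + m ∸ q
  p≤n∸q = m+n≤o⇒m≤o∸n p (subst (_≤ 2 + m) (+-comm q p) q+p≤n)
  s≡ : u′ + a′ + q ≡ 2 + m ∸ q
  s≡ = trans (+-assoc u′ a′ q) (trans (cong (λ x → u′ + x) (m∸n+n≡m q≤p)) (m∸n+n≡m p≤n∸q))
  n≡ : 2 + m ≡ u′ + a′ + (q + q)
  n≡ = sym (trans (sym (+-assoc (u′ + a′) q q)) (trans (cong (_+ q) s≡) (m∸n+n≡m (m+n≤o⇒m≤o q q+p≤n))))

-- From words back to edge sets

perfect⇔configuration : ∀ {m p q} (M : EdgeSet (2 + m)) →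
  (∃ λ c → Configuration (p ∸ q) q c × M ≡ matching c) ⇔ (IsPerfectMatching M × Obtained (p ∸ q) q M)
perfect⇔configuration M = mk⇔
  (λ { (c , (va , d , l) , refl) → matching-perfect c va , matching⇒obtained _ _ c va d l })
  (λ (_ , o) → let (c , eq , va , d , l) = obtained⇒matching o in c , (va , d , l) , eq)

weight⇔ : ∀ k {p} (M : EdgeSet (suc k * 2)) →
  (∃ λ c → (Valid c × #D c + #L c ≡ p) × M ≡ matching c) ⇔
  (IsPerfectMatching M × weight M ≡ (+ (suc k * 2 / 2) - + p , 0ℤ))
weight⇔ k {p} M = mk⇔ forth back
  where
  forth : (∃ λ c → (Valid c × #D c + #L c ≡ p) × M ≡ matching c) →
          IsPerfectMatching M × weight M ≡ (+ (suc k * 2 / 2) - + p , 0ℤ)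
  forth (c , (va , refl) , refl) = matching-perfect c va , cong₂ _,_ z w
    where
    z : zWeight (matching c) ≡ + (suc k * 2 / 2) - + (#D c + #L c)
    z = begin
      zWeight (matching c)
        ≡⟨ //-rightDividesʳ (+ (#D c + #L c)) (zWeight (matching c)) ⟨
      zWeight (matching c) ℤ.+ + (#D c + #L c) - + (#D c + #L c)
        ≡⟨ cong (_- + (#D c + #L c)) (zWeight-matching (suc k) c va) ⟩
      + suc k - + (#D c + #L c)
        ≡⟨ cong (λ x → + x - + (#D c + #L c)) (m*n/n≡m (suc k) 2) ⟨
      + (suc k * 2 / 2) - + (#D c + #L c) ∎
      where open ≡-Reasoning
    last = fromℕ (suc (k * 2))
    w : wWeight (matching c) ≡ 0ℤ
    w = from (wWeight≡0 (matching c)) (trans (member-h c zero last) (sym (member-h c (suc zero) last)))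
  back : IsPerfectMatching M × weight M ≡ (+ (suc k * 2 / 2) - + p , 0ℤ) →
         ∃ λ c → (Valid c × #D c + #L c ≡ p) × M ≡ matching c
  back (perfect , wt) with balanced⇒matching {M = M} (perfect⇒local perfect)
                             (balanced {M = M} (perfect⇒local perfect) (to (wWeight≡0 M) (cong proj₂ wt)))
  -- Adding either `#D c + #L c` or `p` to `suc k - p` gives `suc k`, so the two agree.
  ... | c , va , M≡ = c , (va , ℤ.+-injective (∙-cancelˡ (+ suc k - + p) (+ (#D c + #L c)) (+ p) (begin
      + suc k - + p ℤ.+ + (#D c + #L c)
        ≡⟨ cong (λ x → + x - + p ℤ.+ + (#D c + #L c)) (m*n/n≡m (suc k) 2) ⟨
      + (suc k * 2 / 2) - + p ℤ.+ + (#D c + #L c)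
        ≡⟨ cong (ℤ._+ + (#D c + #L c)) (trans (cong zWeight (sym M≡)) (cong proj₁ wt)) ⟨
      zWeight (matching c) ℤ.+ + (#D c + #L c)
        ≡⟨ zWeight-matching (suc k) c va ⟩
      + suc k
        ≡⟨ //-rightDividesˡ (+ p) (+ suc k) ⟨
      + suc k - + p ℤ.+ + p ∎))) , M≡
    where open ≡-Reasoning

-- The words are sorted by their number of dimers, which is at most `p`; the remaining `p - q` units
-- of lost z-weight are down columns.
total-count : ∀ m p → p ≤ 2 + m →
  ∃ λ b → HasCount {Vec State (2 + m)} (λ c → Valid c × #D c + #L c ≡ p) b × fromNat b ≡ sumFormula (2 + m) p
total-count m p p≤n =
  let (b , hc , b≡) = count-sum (suc p) (λ i → Configuration (p ∸ toℕ i) (toℕ i)) (λ i → summand (2 + m) p (toℕ i))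
                        (λ (_ , _ , i≡) (_ , _ , j≡) → toℕ-injective (trans (sym i≡) j≡))
                        (λ i → let (b , hc , _ , _ , b≡) = configuration-count m p (toℕ i) (i≤p i) p≤n in b , hc , b≡)
  in b , count-⇔ (λ c → mk⇔ (λ (i , va , d , l) → va , trans (cong₂ _+_ d l) (m∸n+n≡m (i≤p i))) (split c)) hc , b≡
  where
  i≤p : (i : Fin (suc p)) → toℕ i ≤ p
  i≤p i = s≤s⁻¹ (toℕ<n i)
  split : ∀ c → Valid c × #D c + #L c ≡ p → ∃ λ (i : Fin (suc p)) → Configuration (p ∸ toℕ i) (toℕ i) c
  split c (va , total) = fromℕ< L< , va ,
    trans (sym (m+n∸n≡m (#D c) (#L c))) (cong₂ _∸_ total (sym (toℕ-fromℕ< L<))) , sym (toℕ-fromℕ< L<)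
    where
    L< : #L c < suc p
    L< = s≤s (subst (#L c ≤_) total (m≤n+m (#L c) (#D c)))

mainTheorem3 : ∀ n → 2 ≤ n → 2 ∣ n → ∀ p → p ≤ n →
    (∀ q → q ≤ p →
    ∃ λ b → HasCount {EdgeSet n} (λ M → IsPerfectMatching M × Obtained (p ∸ q) q M) b
    × fromNat b ≡ factorialFormula n p q
    × factorialFormula n p q ≡ binomialFormula n p q)
    × (∃ λ b → HasCount {EdgeSet n} (λ M → IsPerfectMatching M × weight M ≡ (+ (n / 2) - + p , 0ℤ)) b
    × fromNat b ≡ sumFormula n p)
mainTheorem3 _ () (divides zero refl) p p≤n
-- Here `n` is `suc k * 2`, which computes to `2 + k * 2`, the form required by the counts.
mainTheorem3 _ _ (divides (suc k) refl) p p≤n =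
  (λ q q≤p → let (b , hc , f≡ , f≡b , _) = configuration-count (k * 2) p q q≤p p≤n in
     b , count-⇔ (perfect⇔configuration {p = p}) (count-image matching-injective hc) , f≡ , f≡b) ,
  (let (b , hc , b≡) = total-count (k * 2) p p≤n in
     b , count-⇔ (weight⇔ k) (count-image matching-injective hc) , b≡)
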